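{- Let $\mathbf{x}$ be a point in $\mathbb{R}^2$ with irrational slope and let $y$ be an irrational real number having irrationality measure $\omega(y)=1$. Then the upper bound $$\mu(\mathbf{x},\mathbf{y})\le\frac12$$ holds for almost all points $\mathbf{y}$ of the line $\mathbb{R}\begin{pmatrix} y \\ 1 \end{pmatrix}$ (with respect to one-dimensional Lebesgue measure on this line).
   Context: $\Gamma=\mathrm{SL}(2,\mathbb{Z})$ acts on column vectors of $\mathbb{R}^2$ by left multiplication. For $\mathbf{z}=\begin{pmatrix} z_1 \\ z_2 \end{pmatrix}$, $|\mathbf{z}|=\max(|z_1|,|z_2|)$, and the slope of $\mathbf{z}$ is $z_1/z_2$ (when $z_2\neq0$). For a matrix $\gamma$, $|\gamma|$ is the maximum of the absolute values of its entries. For an irrational real number $\alpha$, the irrationality measure $\omega(\alpha)$ is the supremum of the real numbers $\omega$ such that $|v\alpha+u|\le|v|^{ -\omega}$ has infinitely many solutions in integers $(v,u)$ with $v\neq0$. For $\mathbf{x},\mathbf{y}\in\mathbb{R}^2$, $\mu(\mathbf{x},\mathbf{y})$ is the supremum of the real numbers $\mu$ for which there exist infinitely many $\gamma\in\Gamma$ with $|\gamma\mathbf{x}-\mathbf{y}|\le|\gamma|^{ -\mu}$. -}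

module Defs where

open import Algebra.Bundles using (CommutativeRing; Semiring)
open import Algebra.Core using (Op₁)
import Algebra.Construct.NaturalChoice.Max as Max
import Algebra.Definitions.RawSemiring as RawSemiringDefs
open import Axiom.ExcludedMiddle using (ExcludedMiddle)
open import Data.Fin.Base using (Fin; toℕ)
open import Data.Integer.Base as ℤ using (ℤ; +_; -[1+_]; 0ℤ; 1ℤ)
open import Data.List.Base using (List)
open import Data.List.Membership.Propositional using (_∈_)
open import Data.Nat.Base as ℕ using (ℕ; suc)
open import Data.Product.Base using (_×_; _,_; ∃; ∃₂; proj₁)
open import Data.Rational.Base using (ℚ; ↥_; ↧_; ↧ₙ_)
open import Level using (0ℓ)
open import Relation.Binary.Bundles using (TotalOrder)
open import Relation.Binary.Core using (Rel)
open import Relation.Binary.PropositionalEquality.Core using (_≡_)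
open import Relation.Binary.Structures using (IsTotalOrder)
import Relation.Binary.Construct.Add.Extrema.Equality as AddExtremaEquality
import Relation.Binary.Construct.Add.Extrema.NonStrict as AddExtremaNonStrict
import Relation.Binary.Construct.NonStrictToStrict as NonStrictToStrict
open import Relation.Nullary.Construct.Add.Extrema using (_±; ⊥±; [_]; ⊤±)
open import Relation.Nullary.Decidable.Core using (yes; no)
open import Relation.Nullary.Negation.Core using (¬_)
open import Relation.Unary using (Pred; _∩_)

Finite : {A : Set} → Pred A 0ℓ → Set
Finite {A} P = ∃ λ (xs : List A) → ∀ {x} → P x → x ∈ xs

Infinite : {A : Set} → Pred A 0ℓ → Set
Infinite P = ¬ Finite P

module Bounds {A : Set} (_≤_ : Rel A 0ℓ) where

  IsUpperBound : Pred A 0ℓ → Pred A 0ℓ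
  IsUpperBound P u = ∀ {x} → P x → x ≤ u

  IsLub : Pred A 0ℓ → Pred A 0ℓ
  IsLub P s = IsUpperBound P s × (∀ {u} → IsUpperBound P u → s ≤ u)

-- The second-order axioms of ℝ, which determine it up to isomorphism.
-- Equality is a setoid equality, so that constructions of ℝ without
-- quotient types are models.
record CompleteOrderedField : Set₁ where
  infix 4 _≤_
  infix 8 _⁻¹
  field
    commutativeRing : CommutativeRing 0ℓ 0ℓ

  open CommutativeRing commutativeRing public

  field
    0≉1          : ¬ (0# ≈ 1#)
    -- The value of 0# ⁻¹ is left unspecified.
    _⁻¹          : Op₁ Carrier
    *-inverseʳ   : ∀ {x} → ¬ (x ≈ 0#) → x * x ⁻¹ ≈ 1#

    _≤_          : Rel Carrier 0ℓ
    isTotalOrder : IsTotalOrder _≈_ _≤_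
    +-monoˡ-≤    : ∀ {x y} z → x ≤ y → x + z ≤ y + z
    *-nonNeg     : ∀ {x y} → 0# ≤ x → 0# ≤ y → 0# ≤ x * y

  open Bounds _≤_ public

  field
    complete     : (P : Pred Carrier 0ℓ) → ∃ P → ∃ (IsUpperBound P) →
                   ∃ (IsLub P)

  totalOrder : TotalOrder 0ℓ 0ℓ 0ℓ
  totalOrder = record { isTotalOrder = isTotalOrder }

record Matrix₂ (A : Set) : Set where
  constructor matrix
  field
    a₁₁ a₁₂ a₂₁ a₂₂ : A

open Matrix₂ public

det : Matrix₂ ℤ → ℤ
det γ = a₁₁ γ ℤ.* a₂₂ γ ℤ.- a₁₂ γ ℤ.* a₂₁ γ

SL₂ℤ : Pred (Matrix₂ ℤ) 0ℓ
SL₂ℤ γ = det γ ≡ 1ℤ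

∥_∥ᴹ : Matrix₂ ℤ → ℕ
∥ matrix a b c d ∥ᴹ = ℤ.∣ a ∣ ℕ.⊔ ℤ.∣ b ∣ ℕ.⊔ ℤ.∣ c ∣ ℕ.⊔ ℤ.∣ d ∣

module Real (em : ExcludedMiddle 0ℓ) (R : CompleteOrderedField) where

  open CompleteOrderedField R public
    renaming (Carrier to ℝ) using
    ( _≈_; _+_; _*_; -_; _-_; 0#; 1#; _⁻¹; _≤_; totalOrder
    ; IsUpperBound; IsLub; complete; semiring )
  open NonStrictToStrict _≈_ _≤_ public using (_<_)
  open Max totalOrder public using (_⊔_)
  open RawSemiringDefs (Semiring.rawSemiring semiring) public
    using (sum) renaming (_×_ to _·_; _^_ to _^ᴺ_)

  open AddExtremaEquality _≈_ public using (_≈±_)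
  open AddExtremaNonStrict _≤_ public using (_≤±_)

  fromℕ : ℕ → ℝ
  fromℕ n = n · 1#

  fromℤ : ℤ → ℝ
  fromℤ (+ n)    = fromℕ n
  fromℤ -[1+ n ] = - fromℕ (suc n)

  fromℚ : ℚ → ℝ
  fromℚ q = fromℤ (↥ q) * fromℤ (↧ q) ⁻¹

  Irrational : Pred ℝ 0ℓ
  Irrational α = ∀ q → ¬ (α ≈ fromℚ q)

  ∣_∣ : ℝ → ℝ
  ∣ x ∣ = x ⊔ - x

  -- Supremum in the extended reals.
  ⨆ : Pred ℝ 0ℓ → ℝ ±
  ⨆ P with em {∃ P} | em {∃ (IsUpperBound P)}
  ... | no  _  | _      = ⊥±
  ... | yes _  | no  _  = ⊤±
  ... | yes ne | yes bd = [ proj₁ (complete P ne bd) ]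

  infixr 8 _^ℤ_ _^_

  _^ℤ_ : ℝ → ℤ → ℝ
  x ^ℤ (+ n)    = x ^ᴺ n
  x ^ℤ -[1+ n ] = (x ^ᴺ suc n) ⁻¹

  IsRationalPower : ℝ → ℚ → Pred ℝ 0ℓ
  IsRationalPower b q r = 0# < r × r ^ᴺ (↧ₙ q) ≈ b ^ℤ (↥ q)

  -- Real powers b ^ s = sup { b ^ q ∣ q ∈ ℚ, q ≤ s } of an integer b,
  -- correct for b ≥ 1 only.  For such b the set is inhabited and bounded,
  -- so the value is finite.
  _^_ : ℕ → ℝ → ℝ ±
  b ^ s = ⨆ λ r → ∃ λ q → fromℚ q ≤ s × IsRationalPower (fromℕ b) q r

  ω : ℝ → ℝ ±
  ω α = ⨆ λ w → Infinite {ℤ × ℤ} λ where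
    (v , u) → ¬ (v ≡ 0ℤ) ×
              [ ∣ fromℤ v * α + fromℤ u ∣ ] ≤± ℤ.∣ v ∣ ^ (- w)

  ℝ² : Set
  ℝ² = ℝ × ℝ

  ∥_∥ : ℝ² → ℝ
  ∥ z₁ , z₂ ∥ = ∣ z₁ ∣ ⊔ ∣ z₂ ∣

  _-²_ : ℝ² → ℝ² → ℝ²
  (x₁ , x₂) -² (y₁ , y₂) = x₁ - y₁ , x₂ - y₂

  _•_ : ℝ → ℝ² → ℝ²
  t • (z₁ , z₂) = t * z₁ , t * z₂

  _▹_ : Matrix₂ ℤ → ℝ² → ℝ²
  matrix a b c d ▹ (z₁ , z₂) =
    fromℤ a * z₁ + fromℤ b * z₂ , fromℤ c * z₁ + fromℤ d * z₂

  HasIrrationalSlope : Pred ℝ² 0ℓ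
  HasIrrationalSlope (z₁ , z₂) = ¬ (z₂ ≈ 0#) × Irrational (z₁ * z₂ ⁻¹)

  μ : ℝ² → ℝ² → ℝ ±
  μ x y = ⨆ λ m → Infinite
    (SL₂ℤ ∩ λ γ → [ ∥ (γ ▹ x) -² y ∥ ] ≤± ∥ γ ∥ᴹ ^ (- m))

  -- Lebesgue null sets: covered by countably many intervals of
  -- arbitrarily small total length.
  Null : Pred ℝ 0ℓ → Set
  Null S = ∀ ε → 0# < ε → ∃₂ λ (a b : ℕ → ℝ) →
    (∀ i → a i ≤ b i) ×
    (∀ n → sum (λ (i : Fin n) → b (toℕ i) - a (toℕ i)) ≤ ε) ×
    (∀ {t} → S t → ∃ λ i → a i ≤ t × t ≤ b i)

  -- Lebesgue measure on the line ℝ d (d ≠ 0) is a constant multiple of the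
  -- image of Lebesgue measure on ℝ under t ↦ t • d, so the null sets agree.
  AlmostAllOnLine : ℝ² → Pred ℝ² 0ℓ → Set
  AlmostAllOnLine d P = Null λ t → ¬ P (t • d)

{-# OPTIONS --safe #-}

-- Fix L ≥ 1 and consider the t with 1/L ≤ |t| ≤ L for which infinitely many γ
-- satisfy |γ x - t (y , 1)| ≤ |γ|^-(1/2 + 1/L).  By Borel–Cantelli it suffices
-- to count the γ with |γ| of order T = 2^(4 L n) that come within
-- ρ = T^-(1/2 + 1/L) of the segment: each such γ accounts for an interval of
-- length 2 ρ.  A Farey bracket of y with denominators of order at most about
-- T^(1/4) (available since ω(y) = 1) gives h ∈ SL₂(ℤ) for which the rows r of
-- h γ are of size at most about T^(3/4) and satisfy |r · x| ≲ T^(-1/4).  A Farey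
-- bracket of the slope of x then gives g ∈ SL₂(ℤ) for which the columns of h γ g
-- are bounded by some X₁ and X₂ with X₁ X₂ ≲ T^(1/2) 2^(2 n).  There are O(X₁ X₂)
-- matrices of determinant 1 with such columns, and X₁ X₂ ρ ≲ 4^-n is summable.

module Submission where

open import Defs
open import Algebra.Solver.Ring.AlmostCommutativeRing using (fromCommutativeRing; _-Raw-AlmostCommutative⟶_)
open import Axiom.ExcludedMiddle using (ExcludedMiddle)
open import Data.Empty using (⊥; ⊥-elim)
open import Data.Fin.Base using (Fin; toℕ)
open import Data.Integer.Base as ℤ using (ℤ; +_; -[1+_]; +[1+_]; 0ℤ; 1ℤ)
open import Data.Integer.GCD using (gcd)
open import Data.List.Base as List using (List; []; _∷_; _++_; length; map; concatMap; cartesianProductWith; upTo)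
open import Data.List.Membership.Propositional using (_∈_)
open import Data.List.Relation.Unary.Any using (Any; here; there)
open import Data.Maybe.Base using (Maybe; just; nothing)
open import Data.Nat.Base as ℕ using (ℕ; zero; suc)
open import Data.Product.Base using (_×_; _,_; ∃; proj₁; proj₂; uncurry)
open import Data.Rational.Base as ℚ using (ℚ; mkℚ; ↥_; ↧_; ½)
open import Data.Sum.Base using (_⊎_; inj₁; inj₂; [_,_]′)
open import Function.Base using (_∘_; id)
open import Level using (0ℓ)
open import Relation.Binary.Bundles using (TotalOrder)
open import Relation.Binary.PropositionalEquality as ≡ using (_≡_)
open import Relation.Nullary using (¬_; yes; no)
open import Relation.Nullary.Construct.Add.Extrema using ([_])
open import Relation.Nullary.Negation using (contradiction)
open import Relation.Unary using (Pred; _∩_)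
import Algebra.Construct.NaturalChoice.Max as Max
import Algebra.Properties.CommutativeSemiring.Exp
import Algebra.Properties.Ring
import Algebra.Properties.Semiring.Mult
import Algebra.Properties.Semiring.Mult.TCOptimised
import Algebra.Solver.Ring
import Data.Integer.Properties as ℤ
import Data.Integer.Solver
import Data.List.Membership.Propositional as List
import Data.List.Membership.Propositional.Properties as List
import Data.List.Properties as List
import Data.List.Relation.Unary.Any.Properties as Any
import Data.Nat.Coprimality as Coprimality
import Data.Nat.Properties as ℕ
import Data.Nat.Solver
import Data.Rational.Properties as ℚ
import Relation.Binary.Construct.Add.Extrema.NonStrict as AddExtremaNonStrict
import Relation.Binary.Reasoning.PartialOrder as PosetReasoning
import Relation.Binary.Reasoning.Setoid as SetoidReasoning

module ℤSolver = Data.Integer.Solver.+-*-Solver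
module ℕSolver = Data.Nat.Solver.+-*-Solver

-- A row of `h` has entries of order about T^(1/4), so a trivial estimate allows T^(5/4) in a row of
-- `h γ`. The gain to T^(3/4) comes from the determinant: as `det γ = 1` and `γ x` is close to
-- `t • (y , 1#)`, the first column of `γ` deviates from the direction `(y , 1)` by at most about T
-- ρ, which is below T^(1/2). The second gain is that one row of a matrix of determinant 1
-- determines the other up to boundedly many choices, so the count is X₁ X₂ and not its square. The
-- hypothesis on ω(y) yields bounds only with an arbitrarily small loss in the exponent. Writing
-- everything in powers of Z = 2^n = T^(1/(4 L)) turns these losses into fixed powers of Z. They are
-- paid for by the extra 1/L in the exponent, which contributes Z^-4 to ρ: Z^2 is lost in X₁ X₂, and
-- the remaining Z^-2 = 4^-n is summable.

module Proof (em : ExcludedMiddle 0ℓ) (R : CompleteOrderedField) where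
  open Real em R
  module F = CompleteOrderedField R
  open F using (refl; sym; trans; reflexive; +-cong; +-congˡ; +-congʳ; *-cong; *-congˡ; *-congʳ; -‿cong)
  open Algebra.Properties.Ring F.ring using (-0#≈0#; -‿involutive; -‿distribˡ-*; -‿distribʳ-*; -‿+-comm)
  private
    module Mult = Algebra.Properties.Semiring.Mult semiring
    module Mult′ = Algebra.Properties.Semiring.Mult.TCOptimised semiring

  -- The integers inside the field, and a ring solver with integer coefficients.

  fromℕ-+ : ∀ m n → fromℕ (m ℕ.+ n) ≈ fromℕ m + fromℕ n
  fromℕ-+ = Mult.×-homo-+ 1#

  fromℕ-* : ∀ m n → fromℕ (m ℕ.* n) ≈ fromℕ m * fromℕ n
  fromℕ-* = Mult.×1-homo-*

  fromℤ-⊖ : ∀ m n → fromℤ (m ℤ.⊖ n) ≈ fromℕ m - fromℕ n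
  fromℤ-⊖ m zero = sym (trans (+-congˡ -0#≈0#) (F.+-identityʳ _))
  fromℤ-⊖ zero (suc n) = sym (F.+-identityˡ _)
  fromℤ-⊖ (suc m) (suc n) = begin
    fromℤ (suc m ℤ.⊖ suc n)            ≡⟨ ≡.cong fromℤ (ℤ.[1+m]⊖[1+n]≡m⊖n m n) ⟩
    fromℤ (m ℤ.⊖ n)                    ≈⟨ fromℤ-⊖ m n ⟩
    fromℕ m - fromℕ n                  ≈⟨ +-congʳ (F.+-identityˡ _) ⟨
    (0# + fromℕ m) - fromℕ n           ≈⟨ +-congʳ (+-congʳ (F.-‿inverseʳ 1#)) ⟨
    ((1# - 1#) + fromℕ m) - fromℕ n    ≈⟨ +-congʳ (F.+-assoc _ _ _) ⟩
    (1# + (- 1# + fromℕ m)) - fromℕ n  ≈⟨ +-congʳ (+-congˡ (F.+-comm _ _)) ⟩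
    (1# + (fromℕ m - 1#)) - fromℕ n    ≈⟨ +-congʳ (F.+-assoc _ _ _) ⟨
    ((1# + fromℕ m) - 1#) - fromℕ n    ≈⟨ F.+-assoc _ _ _ ⟩
    fromℕ (suc m) + (- 1# - fromℕ n)   ≈⟨ +-congˡ (-‿+-comm _ _) ⟩
    fromℕ (suc m) - fromℕ (suc n)      ∎
    where open SetoidReasoning F.setoid

  fromℤ-neg : ∀ i → fromℤ (ℤ.- i) ≈ - fromℤ i
  fromℤ-neg (+ zero)  = sym -0#≈0#
  fromℤ-neg +[1+ n ]  = refl
  fromℤ-neg -[1+ n ]  = sym (-‿involutive _)

  fromℤ-+ : ∀ i j → fromℤ (i ℤ.+ j) ≈ fromℤ i + fromℤ j
  fromℤ-+ (+ m)    (+ n)    = fromℕ-+ m n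
  fromℤ-+ (+ m)    -[1+ n ] = fromℤ-⊖ m (suc n)
  fromℤ-+ -[1+ m ] (+ n)    = trans (fromℤ-⊖ n (suc m)) (F.+-comm _ _)
  fromℤ-+ -[1+ m ] -[1+ n ] = begin
    - fromℕ (suc (suc (m ℕ.+ n)))        ≡⟨ ≡.cong (λ k → - fromℕ (suc k)) (ℕ.+-suc m n) ⟨
    - fromℕ (suc m ℕ.+ suc n)            ≈⟨ -‿cong (fromℕ-+ (suc m) (suc n)) ⟩
    - (fromℕ (suc m) + fromℕ (suc n))    ≈⟨ -‿+-comm _ _ ⟨
    - fromℕ (suc m) - fromℕ (suc n)      ∎
    where open SetoidReasoning F.setoid

  private
    fromℤ-*⁺ : ∀ i n → fromℤ (i ℤ.* + n) ≈ fromℤ i * fromℕ n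
    fromℤ-*⁺ (+ m) n = trans (reflexive (≡.cong fromℤ (≡.sym (ℤ.pos-* m n)))) (fromℕ-* m n)
    fromℤ-*⁺ -[1+ m ] n = begin
      fromℤ (-[1+ m ] ℤ.* + n)         ≡⟨ ≡.cong fromℤ (ℤ.neg-distribˡ-* +[1+ m ] (+ n)) ⟨
      fromℤ (ℤ.- (+[1+ m ] ℤ.* + n))   ≈⟨ fromℤ-neg (+[1+ m ] ℤ.* + n) ⟩
      - fromℤ (+[1+ m ] ℤ.* + n)       ≈⟨ -‿cong (fromℤ-*⁺ +[1+ m ] n) ⟩
      - (fromℕ (suc m) * fromℕ n)      ≈⟨ -‿distribˡ-* _ _ ⟩
      - fromℕ (suc m) * fromℕ n        ∎
      where open SetoidReasoning F.setoid

  fromℤ-* : ∀ i j → fromℤ (i ℤ.* j) ≈ fromℤ i * fromℤ j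
  fromℤ-* i (+ n) = fromℤ-*⁺ i n
  fromℤ-* i -[1+ n ] = begin
    fromℤ (i ℤ.* -[1+ n ])         ≡⟨ ≡.cong fromℤ (ℤ.neg-distribʳ-* i +[1+ n ]) ⟨
    fromℤ (ℤ.- (i ℤ.* +[1+ n ]))   ≈⟨ fromℤ-neg (i ℤ.* +[1+ n ]) ⟩
    - fromℤ (i ℤ.* +[1+ n ])       ≈⟨ -‿cong (fromℤ-*⁺ i (suc n)) ⟩
    - (fromℤ i * fromℕ (suc n))    ≈⟨ -‿distribʳ-* _ _ ⟩
    fromℤ i * - fromℕ (suc n)      ∎
    where open SetoidReasoning F.setoid

  fromℤ-- : ∀ i j → fromℤ (i ℤ.- j) ≈ fromℤ i - fromℤ j
  fromℤ-- i j = trans (fromℤ-+ i (ℤ.- j)) (+-congˡ (fromℤ-neg j))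

  -- fromℤ, but sending 1 to 1# definitionally
  private
    coeff : ℤ → ℝ
    coeff (+ n)    = n Mult′.× 1#
    coeff -[1+ n ] = - (suc n Mult′.× 1#)

    coeff≈fromℤ : ∀ i → coeff i ≈ fromℤ i
    coeff≈fromℤ (+ n)    = sym (Mult′.×ᵤ≈× n 1#)
    coeff≈fromℤ -[1+ n ] = -‿cong (sym (Mult′.×ᵤ≈× (suc n) 1#))

    almostCommutativeRing = fromCommutativeRing F.commutativeRing

    morphism : ℤ.+-*-rawRing -Raw-AlmostCommutative⟶ almostCommutativeRing
    morphism = record
      { ⟦_⟧ = coeff
      ; +-homo = λ i j → trans (coeff≈fromℤ (i ℤ.+ j)) (trans (fromℤ-+ i j) (sym (+-cong (coeff≈fromℤ i) (coeff≈fromℤ j))))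
      ; *-homo = λ i j → trans (coeff≈fromℤ (i ℤ.* j)) (trans (fromℤ-* i j) (sym (*-cong (coeff≈fromℤ i) (coeff≈fromℤ j))))
      ; -‿homo = λ i → trans (coeff≈fromℤ (ℤ.- i)) (trans (fromℤ-neg i) (sym (-‿cong (coeff≈fromℤ i))))
      ; 0-homo = refl
      ; 1-homo = refl
      }

    _coeff≟_ : ∀ i j → Maybe (coeff i ≈ coeff j)
    i coeff≟ j with i ℤ.≟ j
    ... | yes i≡j = just (reflexive (≡.cong coeff i≡j))
    ... | no  _   = nothing

  open Algebra.Solver.Ring ℤ.+-*-rawRing almostCommutativeRing morphism _coeff≟_ using (solve; _:=_; _:+_; _:*_; _:-_; :-_; con; _:^_)

  -- Order, the Archimedean property and integer powers.

  open TotalOrder totalOrder using () renaming (refl to ≤-refl; reflexive to ≤-reflexive; trans to ≤-trans; antisym to ≤-antisym; total to ≤-total; ≤-respˡ-≈ to ≤-respˡ; ≤-respʳ-≈ to ≤-respʳ)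
  open Algebra.Properties.CommutativeSemiring.Exp F.commutativeSemiring using (^-congˡ; ^-homo-*; ^-assocʳ; ^-distrib-*)

  ≰⇒≥ : ∀ {x y} → ¬ x ≤ y → y ≤ x
  ≰⇒≥ {x} {y} x≰y = [ (λ p → contradiction p x≰y) , id ]′ (≤-total x y)

  ≰⇒> : ∀ {x y} → ¬ x ≤ y → y < x
  ≰⇒> x≰y = ≰⇒≥ x≰y , λ y≈x → x≰y (≤-reflexive (sym y≈x))

  ≤-stable : ∀ {x y} → (¬ x ≤ y → ⊥) → x ≤ y
  ≤-stable {x} {y} h with em {x ≤ y}
  ... | yes p = p
  ... | no ¬p = ⊥-elim (h ¬p)

  0≤y-x : ∀ {x y} → x ≤ y → 0# ≤ y - x
  0≤y-x {x} x≤y = ≤-respˡ (F.-‿inverseʳ x) (F.+-monoˡ-≤ (- x) x≤y)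

  -- Inequalities are proved by exhibiting y - x as an evidently
  -- nonnegative expression.
  ≤-by : ∀ {x y} c → 0# ≤ c → y - x ≈ c → x ≤ y
  ≤-by {x} {y} c 0≤c eq =
    ≤-respˡ (F.+-identityˡ x) (≤-respʳ (solve 2 (λ x y → (y :- x) :+ x := y) refl x y)
      (F.+-monoˡ-≤ x (≤-respʳ (sym eq) 0≤c)))

  +-mono-≤ : ∀ {a b c d} → a ≤ b → c ≤ d → a + c ≤ b + d
  +-mono-≤ {a} {b} {c} {d} a≤b c≤d = ≤-trans (F.+-monoˡ-≤ c a≤b)
    (≤-respˡ (F.+-comm c b) (≤-respʳ (F.+-comm d b) (F.+-monoˡ-≤ b c≤d)))

  +-nonNeg : ∀ {a b} → 0# ≤ a → 0# ≤ b → 0# ≤ a + b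
  +-nonNeg p q = ≤-respˡ (F.+-identityˡ 0#) (+-mono-≤ p q)

  *-nonNeg = F.*-nonNeg

  neg-mono-≤ : ∀ {a b} → a ≤ b → - b ≤ - a
  neg-mono-≤ {a} {b} p = ≤-by (b - a) (0≤y-x p) (solve 2 (λ a b → :- a :- :- b := b :- a) refl a b)

  *-monoˡ-≤ : ∀ {a b} c → 0# ≤ c → a ≤ b → c * a ≤ c * b
  *-monoˡ-≤ {a} {b} c 0≤c a≤b = ≤-by (c * (b - a)) (*-nonNeg 0≤c (0≤y-x a≤b))
    (solve 3 (λ a b c → c :* b :- c :* a := c :* (b :- a)) refl a b c)

  *-mono-≤ : ∀ {a b c d} → 0# ≤ a → 0# ≤ c → a ≤ b → c ≤ d → a * c ≤ b * d
  *-mono-≤ {a} {b} {c} {d} 0≤a 0≤c a≤b c≤d = ≤-trans (*-monoˡ-≤ a 0≤a c≤d)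
    (≤-respˡ (F.*-comm d a) (≤-respʳ (F.*-comm d b) (*-monoˡ-≤ d (≤-trans 0≤c c≤d) a≤b)))

  0≤1 : 0# ≤ 1#
  0≤1 with ≤-total 0# 1#
  ... | inj₁ p = p
  ... | inj₂ 1≤0 = ≤-respʳ (solve 0 (:- con 1ℤ :* :- con 1ℤ := con 1ℤ) refl) (*-nonNeg 0≤-1 0≤-1)
    where
    0≤-1 : 0# ≤ - 1#
    0≤-1 = ≤-respʳ (F.+-identityˡ _) (0≤y-x 1≤0)

  1≰0 : ¬ 1# ≤ 0#
  1≰0 p = F.0≉1 (≤-antisym 0≤1 p)

  fromℕ-nonNeg : ∀ n → 0# ≤ fromℕ n
  fromℕ-nonNeg zero    = ≤-refl
  fromℕ-nonNeg (suc n) = +-nonNeg 0≤1 (fromℕ-nonNeg n)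

  fromℕ-1 : fromℕ 1 ≈ 1#
  fromℕ-1 = F.+-identityʳ 1#

  fromℕ-mono : ∀ {m n} → m ℕ.≤ n → fromℕ m ≤ fromℕ n
  fromℕ-mono {n = n} ℕ.z≤n = fromℕ-nonNeg n
  fromℕ-mono (ℕ.s≤s p) = +-mono-≤ ≤-refl (fromℕ-mono p)

  1≤fromℕ-suc : ∀ n → 1# ≤ fromℕ (suc n)
  1≤fromℕ-suc n = ≤-respˡ fromℕ-1 (fromℕ-mono {1} {suc n} (ℕ.s≤s ℕ.z≤n))

  fromℕ-cancel : ∀ {m n} → fromℕ m ≤ fromℕ n → m ℕ.≤ n
  fromℕ-cancel {zero}  p = ℕ.z≤n
  fromℕ-cancel {suc m} {zero} p = ⊥-elim (1≰0 (≤-trans (1≤fromℕ-suc m) p))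
  fromℕ-cancel {suc m} {suc n} p = ℕ.s≤s (fromℕ-cancel (≤-by _ (0≤y-x p)
    (solve 3 (λ a b c → b :- a := (c :+ b) :- (c :+ a)) refl (fromℕ m) (fromℕ n) 1#)))

  0<⇒≉0 : ∀ {x} → 0# < x → ¬ x ≈ 0#
  0<⇒≉0 (_ , n) e = n (sym e)

  1≤⇒0< : ∀ {x} → 1# ≤ x → 0# < x
  1≤⇒0< {x} p = ≤-trans 0≤1 p , λ e → 1≰0 (≤-respʳ (sym e) p)

  0≤x⁻¹ : ∀ {x} → 0# < x → 0# ≤ x ⁻¹
  0≤x⁻¹ {x} 0<x = ≤-stable λ h → 1≰0 (≤-by (x * - (x ⁻¹))
    (*-nonNeg (proj₁ 0<x) (≤-respˡ -0#≈0# (neg-mono-≤ (≰⇒≥ h))))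
    (trans (trans (F.+-identityˡ _) (-‿cong (sym (F.*-inverseʳ (0<⇒≉0 0<x))))) (-‿distribʳ-* _ _)))

  *-cancelˡ-≤ : ∀ {a b c} → 0# < c → c * a ≤ c * b → a ≤ b
  *-cancelˡ-≤ {a} {b} {c} 0<c p =
    ≤-respˡ (e a) (≤-respʳ (e b) (*-monoˡ-≤ (c ⁻¹) (0≤x⁻¹ 0<c) p))
    where
    e : ∀ a → c ⁻¹ * (c * a) ≈ a
    e a = trans (solve 3 (λ a c d → d :* (c :* a) := (c :* d) :* a) refl a c (c ⁻¹))
      (trans (*-congʳ (F.*-inverseʳ (0<⇒≉0 0<c))) (F.*-identityˡ a))

  *-cancelˡ-≈ : ∀ {a b c} → ¬ c ≈ 0# → c * a ≈ c * b → a ≈ b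
  *-cancelˡ-≈ {a} {b} {c} c≉0 p = trans (sym (e a)) (trans (*-congˡ p) (e b))
    where
    e : ∀ a → c ⁻¹ * (c * a) ≈ a
    e a = trans (solve 3 (λ a c d → d :* (c :* a) := (c :* d) :* a) refl a c (c ⁻¹))
      (trans (*-congʳ (F.*-inverseʳ c≉0)) (F.*-identityˡ a))

  archimedean : ∀ x → ∃ λ n → x ≤ fromℕ n
  archimedean x with em {∃ λ n → x ≤ fromℕ n}
  ... | yes p = p
  ... | no ¬p with F.complete (λ r → ∃ λ n → r ≈ fromℕ n) (0# , 0 , refl)
                     (x , λ (n , r≈n) → ≤-respˡ (sym r≈n) (≰⇒≥ λ q → ¬p (n , q)))
  -- Every successor is at most `s`, so `s - 1#` is an upper bound as well, and leastness gives s ≤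
  -- s - 1.
  ... | s , ub , lub = ⊥-elim (1≰0 (≤-by _ (0≤y-x (lub {s - 1#} λ {r} (n , r≈n) → ≤-by _ (0≤y-x (ub (suc n , refl)))
      (trans (+-congˡ (-‿cong r≈n)) (solve 3 (λ s n o → (s :- o) :- n := s :- (o :+ n)) refl s (fromℕ n) 1#))))
      (solve 2 (λ s o → con 0ℤ :- o := (s :- o) :- s) refl s 1#)))

  pow-nonNeg : ∀ {x} n → 0# ≤ x → 0# ≤ x ^ᴺ n
  pow-nonNeg zero    p = 0≤1
  pow-nonNeg (suc n) p = *-nonNeg p (pow-nonNeg n p)

  pow-mono : ∀ {x y} n → 0# ≤ x → x ≤ y → x ^ᴺ n ≤ y ^ᴺ n
  pow-mono zero    0≤x x≤y = ≤-refl
  pow-mono (suc n) 0≤x x≤y = *-mono-≤ 0≤x (pow-nonNeg n 0≤x) x≤y (pow-mono n 0≤x x≤y)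

  1^n≈1 : ∀ n → 1# ^ᴺ n ≈ 1#
  1^n≈1 zero = refl
  1^n≈1 (suc n) = trans (F.*-identityˡ _) (1^n≈1 n)

  1≤pow : ∀ {x} n → 1# ≤ x → 1# ≤ x ^ᴺ n
  1≤pow n p = ≤-respˡ (1^n≈1 n) (pow-mono n 0≤1 p)

  pow≤1 : ∀ {x} n → 0# ≤ x → x ≤ 1# → x ^ᴺ n ≤ 1#
  pow≤1 n 0≤x p = ≤-respʳ (1^n≈1 n) (pow-mono n 0≤x p)

  -- Inequalities between fractional powers are proved by raising both sides to an integer power;
  -- this removes it again. If `y < x`, one factor `y` on the right may be replaced by `x` and
  -- cancelled, which lowers the exponent.
  pow-cancel-≤ : ∀ {x y} n → 0# ≤ x → 0# ≤ y → x ^ᴺ suc n ≤ y ^ᴺ suc n → x ≤ y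
  pow-cancel-≤ {x} {y} zero 0≤x 0≤y p = ≤-respˡ (F.*-identityʳ x) (≤-respʳ (F.*-identityʳ y) p)
  pow-cancel-≤ {x} {y} (suc n) 0≤x 0≤y p = ≤-stable λ x≰y →
    let y<x = ≰⇒> x≰y
        0<x = ≤-trans 0≤y (proj₁ y<x) , λ 0≈x → x≰y (≤-respˡ 0≈x 0≤y)
    in x≰y (pow-cancel-≤ n 0≤x 0≤y (*-cancelˡ-≤ 0<x
         (≤-trans p (*-mono-≤ 0≤y (pow-nonNeg (suc n) 0≤y) (proj₁ y<x) ≤-refl))))

  pow-monoʳ : ∀ {x m n} → 1# ≤ x → m ℕ.≤ n → x ^ᴺ m ≤ x ^ᴺ n
  pow-monoʳ {n = n} 1≤x ℕ.z≤n = 1≤pow n 1≤x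
  pow-monoʳ 1≤x (ℕ.s≤s p) = *-monoˡ-≤ _ (≤-trans 0≤1 1≤x) (pow-monoʳ 1≤x p)

  pow-antiʳ : ∀ {x m n} → 0# ≤ x → x ≤ 1# → m ℕ.≤ n → x ^ᴺ n ≤ x ^ᴺ m
  pow-antiʳ {n = n} 0≤x x≤1 ℕ.z≤n = pow≤1 n 0≤x x≤1
  pow-antiʳ 0≤x x≤1 (ℕ.s≤s p) = *-monoˡ-≤ _ 0≤x (pow-antiʳ 0≤x x≤1 p)

  fromℕ-^ : ∀ m n → fromℕ (m ℕ.^ n) ≈ fromℕ m ^ᴺ n
  fromℕ-^ m zero    = fromℕ-1
  fromℕ-^ m (suc n) = trans (fromℕ-* m (m ℕ.^ n)) (*-congˡ (fromℕ-^ m n))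

  module ⊔ = Max totalOrder

  module ≤-Reasoning = PosetReasoning (TotalOrder.poset totalOrder)

  -- Two-sided bounds and explicit big-O estimates.

  private
    0≤w+w⇒0≤w : ∀ {w} → 0# ≤ w + w → 0# ≤ w
    0≤w+w⇒0≤w {w} p = ≤-stable λ h → h (≤-trans p (≤-respʳ (F.+-identityʳ w) (+-mono-≤ ≤-refl (≰⇒≥ h))))

  infix 4 _≼_

  -- Encodes `∣ x ∣ ≤ b` by two linear inequalities, which ring identities can handle without `_⊔_`.
  _≼_ : ℝ → ℝ → Set
  x ≼ b = x ≤ b × - x ≤ b

  ≼-resp : ∀ {x y b} → x ≈ y → x ≼ b → y ≼ b
  ≼-resp e (p , q) = ≤-respˡ e p , ≤-respˡ (-‿cong e) q

  ≼-trans : ∀ {x b c} → x ≼ b → b ≤ c → x ≼ c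
  ≼-trans (p , q) r = ≤-trans p r , ≤-trans q r

  ≼-neg : ∀ {x b} → x ≼ b → - x ≼ b
  ≼-neg (p , q) = q , ≤-respˡ (sym (-‿involutive _)) p

  ≼-+ : ∀ {x y a b} → x ≼ a → y ≼ b → x + y ≼ a + b
  ≼-+ (p , q) (p′ , q′) = +-mono-≤ p p′ , ≤-respˡ (-‿+-comm _ _) (+-mono-≤ q q′)

  -- Adding two products of the nonnegative numbers a ± x and b ± y, with suitable signs, cancels
  -- the cross terms and leaves twice the required difference.
  ≼-* : ∀ {x y a b} → x ≼ a → y ≼ b → x * y ≼ a * b
  ≼-* {x} {y} {a} {b} (x≤a , -x≤a) (y≤b , -y≤b) =
    ≤-by _ (0≤w+w⇒0≤w (≤-respʳ
      (solve 4 (λ a b x y → (a :- x) :* (b :- :- y) :+ (a :- :- x) :* (b :- y)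
                         := (a :* b :- x :* y) :+ (a :* b :- x :* y)) refl a b x y)
      (+-nonNeg (*-nonNeg (0≤y-x x≤a) (0≤y-x -y≤b)) (*-nonNeg (0≤y-x -x≤a) (0≤y-x y≤b))))) refl ,
    ≤-by _ (0≤w+w⇒0≤w (≤-respʳ
      (solve 4 (λ a b x y → (a :- x) :* (b :- y) :+ (a :- :- x) :* (b :- :- y)
                         := (a :* b :- :- (x :* y)) :+ (a :* b :- :- (x :* y))) refl a b x y)
      (+-nonNeg (*-nonNeg (0≤y-x x≤a) (0≤y-x y≤b)) (*-nonNeg (0≤y-x -x≤a) (0≤y-x -y≤b))))) refl

  ≼-nonNeg : ∀ {x b} → x ≼ b → 0# ≤ b
  ≼-nonNeg {x} {b} (p , q) = 0≤w+w⇒0≤w (≤-respˡ (F.-‿inverseʳ x) (+-mono-≤ p q))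

  0≤x⇒x≼x : ∀ {x} → 0# ≤ x → x ≼ x
  0≤x⇒x≼x p = ≤-refl , ≤-trans (≤-respʳ -0#≈0# (neg-mono-≤ p)) p

  ∃-bound : ∀ x → ∃ λ n → x ≼ fromℕ n
  ∃-bound x =
    let m , p = archimedean x
        n , q = archimedean (- x)
    in m ℕ.+ n , ≤-trans p (fromℕ-mono (ℕ.m≤m+n m n)) , ≤-trans q (fromℕ-mono (ℕ.m≤n+m n m))

  -- x = O(g) with constant C.  Keeping C as an index makes it visible that
  -- the constant is uniform over everything g and x depend on.
  record Big-O (x C g : ℝ) : Set where
    constructor big-O
    field
      0≤C   : 0# ≤ C
      bound : x ≼ C * g

  O-+ : ∀ {x y C D g} → Big-O x C g → Big-O y D g → Big-O (x + y) (C + D) g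
  O-+ (big-O p q) (big-O p′ q′) = big-O (+-nonNeg p p′) (≼-trans (≼-+ q q′) (≤-reflexive (sym (F.distribʳ _ _ _))))

  O-neg : ∀ {x C g} → Big-O x C g → Big-O (- x) C g
  O-neg (big-O p q) = big-O p (≼-neg q)

  O-* : ∀ {x y C D g h} → Big-O x C g → Big-O y D h → Big-O (x * y) (C * D) (g * h)
  O-* {C = C} {D} {g} {h} (big-O p q) (big-O p′ q′) = big-O (*-nonNeg p p′)
    (≼-trans (≼-* q q′) (≤-reflexive (solve 4 (λ C D g h → (C :* g) :* (D :* h) := (C :* D) :* (g :* h)) refl C D g h)))

  O-weaken : ∀ {x C g h} → Big-O x C g → g ≤ h → Big-O x C h
  O-weaken (big-O p q) r = big-O p (≼-trans q (*-monoˡ-≤ _ p r))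

  O-resp : ∀ {x y C g} → x ≈ y → Big-O x C g → Big-O y C g
  O-resp e (big-O p q) = big-O p (≼-resp e q)

  O-scale : ∀ {x y C D g} → Big-O x C g → y ≼ D → Big-O (y * x) (D * C) g
  O-scale {C = C} {D} {g} (big-O p q) r = big-O (*-nonNeg (≼-nonNeg r) p)
    (≼-trans (≼-* r q) (≤-reflexive (sym (F.*-assoc D C g))))

  O-self : ∀ {g} → 0# ≤ g → Big-O g 1# g
  O-self p = big-O 0≤1 (≼-trans (0≤x⇒x≼x p) (≤-reflexive (sym (F.*-identityˡ _))))

  -- Integer parts and Farey brackets.

  floorℕ : ∀ r → 0# ≤ r → ∃ λ n → fromℕ n ≤ r × (∀ m → fromℕ m ≤ r → m ℕ.≤ n)
  floorℕ r 0≤r = let n , r≤n = archimedean r in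
      search n λ m m≤r → fromℕ-cancel (≤-trans m≤r r≤n)
    where
    search : ∀ n → (∀ m → fromℕ m ≤ r → m ℕ.≤ n) →
             ∃ λ n → fromℕ n ≤ r × (∀ m → fromℕ m ≤ r → m ℕ.≤ n)
    search zero    ub = 0 , 0≤r , ub
    search (suc n) ub with em {fromℕ (suc n) ≤ r}
    ... | yes p = suc n , p , ub
    ... | no ¬p = search n λ m m≤r → ℕ.≤-pred (ℕ.≤∧≢⇒< (ub m m≤r) λ { ≡.refl → ¬p m≤r })

  floorℤ : ∀ y → ∃ λ i → fromℤ i ≤ y × y ≤ fromℤ (1ℤ ℤ.+ i)
  floorℤ y =
    let k , -y≤k = archimedean (- y)
        n , n≤ , ub = floorℕ (fromℕ k + y) (≤-by _ (0≤y-x -y≤k) (solve 2 (λ y k → (k :+ y) :- con 0ℤ := k :- :- y) refl y (fromℕ k)))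
    in + n ℤ.- + k
     , ≤-respˡ (sym (fromℤ-- (+ n) (+ k))) (≤-by _ (0≤y-x n≤)
         (solve 3 (λ y n k → y :- (n :- k) := (k :+ y) :- n) refl y (fromℕ n) (fromℕ k)))
     , ≤-respʳ (sym (trans (fromℤ-+ 1ℤ (+ n ℤ.- + k)) (+-cong fromℕ-1 (fromℤ-- (+ n) (+ k)))))
         (≤-by _ (0≤y-x (≰⇒≥ λ p → ℕ.<-irrefl ≡.refl (ub (suc n) p)))
           (solve 3 (λ y n k → (con 1ℤ :+ (n :- k)) :- y := (con 1ℤ :+ n) :- (k :+ y)) refl y (fromℕ n) (fromℕ k)))

  -- Fractions p/q ≤ y ≤ p′/q′ that are adjacent in a Farey sequence.
  record Bracket (y : ℝ) : Set where
    field
      q q′  : ℕ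
      p p′  : ℤ
      1≤q   : 1 ℕ.≤ q
      1≤q′  : 1 ℕ.≤ q′
      det≡1 : + q ℤ.* p′ ℤ.- + q′ ℤ.* p ≡ 1ℤ
      0≤α   : 0# ≤ fromℕ q * y - fromℤ p
      0≤α′  : 0# ≤ fromℤ p′ - fromℕ q′ * y

    α α′ : ℝ
    α  = fromℕ q * y - fromℤ p
    α′ = fromℤ p′ - fromℕ q′ * y

    1≤fromℕ-q : 1# ≤ fromℕ q
    1≤fromℕ-q = ≤-respˡ fromℕ-1 (fromℕ-mono 1≤q)

    1≤fromℕ-q′ : 1# ≤ fromℕ q′
    1≤fromℕ-q′ = ≤-respˡ fromℕ-1 (fromℕ-mono 1≤q′)

    det≈1 : fromℕ q * fromℤ p′ - fromℕ q′ * fromℤ p ≈ 1#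
    det≈1 = begin
      fromℕ q * fromℤ p′ - fromℕ q′ * fromℤ p      ≈⟨ +-cong (fromℤ-* (+ q) p′) (-‿cong (fromℤ-* (+ q′) p)) ⟨
      fromℤ (+ q ℤ.* p′) - fromℤ (+ q′ ℤ.* p)      ≈⟨ fromℤ-- (+ q ℤ.* p′) (+ q′ ℤ.* p) ⟨
      fromℤ (+ q ℤ.* p′ ℤ.- + q′ ℤ.* p)            ≡⟨ ≡.cong fromℤ det≡1 ⟩
      fromℕ 1                                      ≈⟨ fromℕ-1 ⟩
      1#                                           ∎
      where open SetoidReasoning F.setoid

    -- Eliminating `y` from the two errors leaves the determinant. The mixed term in the later
    -- estimate of X₁ X₂ is evaluated by the same identity.
    qα′+q′α≈1 : fromℕ q * α′ + fromℕ q′ * α ≈ 1#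
    qα′+q′α≈1 = trans
      (solve 5 (λ q q′ p p′ y → q :* (p′ :- q′ :* y) :+ q′ :* (q :* y :- p) := q :* p′ :- q′ :* p)
        refl (fromℕ q) (fromℕ q′) (fromℤ p) (fromℤ p′) y)
      det≈1

    qα′≤1 : fromℕ q * α′ ≤ 1#
    qα′≤1 = ≤-by _ (*-nonNeg (fromℕ-nonNeg q′) 0≤α)
      (trans (+-congʳ (sym qα′+q′α≈1)) (solve 2 (λ a b → (a :+ b) :- a := b) refl (fromℕ q * α′) (fromℕ q′ * α)))

    q′α≤1 : fromℕ q′ * α ≤ 1#
    q′α≤1 = ≤-by _ (*-nonNeg (fromℕ-nonNeg q) 0≤α′)
      (trans (+-congʳ (sym qα′+q′α≈1)) (solve 2 (λ a b → (a :+ b) :- b := a) refl (fromℕ q * α′) (fromℕ q′ * α)))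

  module _ {y : ℝ} where
    open ℤSolver using () renaming (solve to solveℤ; _:=_ to _⊜_; _:+_ to _⊕_; _:*_ to _⊗_; _:-_ to _⊖_)

    floorBracket : Bracket y
    floorBracket = let i , i≤y , y≤1+i = floorℤ y in record
      { q = 1 ; q′ = 1 ; p = i ; p′ = 1ℤ ℤ.+ i ; 1≤q = ℕ.≤-refl ; 1≤q′ = ℕ.≤-refl
      ; det≡1 = solveℤ 1 (λ i → ℤSolver.con 1ℤ ⊗ (ℤSolver.con 1ℤ ⊕ i) ⊖ ℤSolver.con 1ℤ ⊗ i ⊜ ℤSolver.con 1ℤ) ≡.refl i
      ; 0≤α  = ≤-respʳ (+-congʳ (sym 1*y≈y)) (0≤y-x i≤y)
      ; 0≤α′ = ≤-respʳ (+-congˡ (-‿cong (sym 1*y≈y))) (0≤y-x y≤1+i)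
      }
      where
      1*y≈y : fromℕ 1 * y ≈ y
      1*y≈y = trans (*-congʳ fromℕ-1) (F.*-identityˡ y)

    module _ (B : Bracket y) where
      open Bracket B

      mediantˡ : α′ ≤ α → Bracket y
      mediantˡ α′≤α = record
        { q = q ℕ.+ q′ ; q′ = q′ ; p = p ℤ.+ p′ ; p′ = p′ ; 1≤q = ℕ.≤-trans 1≤q (ℕ.m≤m+n q q′) ; 1≤q′ = 1≤q′
        ; det≡1 = ≡.trans (solveℤ 4 (λ q q′ p p′ → (q ⊕ q′) ⊗ p′ ⊖ q′ ⊗ (p ⊕ p′) ⊜ q ⊗ p′ ⊖ q′ ⊗ p) ≡.refl (+ q) (+ q′) p p′) det≡1
        ; 0≤α  = ≤-respʳ (sym (trans (+-cong (*-congʳ (fromℕ-+ q q′)) (-‿cong (fromℤ-+ p p′)))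
            (solve 5 (λ q q′ p p′ y → (q :+ q′) :* y :- (p :+ p′) := (q :* y :- p) :- (p′ :- q′ :* y))
              refl (fromℕ q) (fromℕ q′) (fromℤ p) (fromℤ p′) y))) (0≤y-x α′≤α)
        ; 0≤α′ = 0≤α′
        }

      mediantʳ : α ≤ α′ → Bracket y
      mediantʳ α≤α′ = record
        { q = q ; q′ = q ℕ.+ q′ ; p = p ; p′ = p ℤ.+ p′ ; 1≤q = 1≤q ; 1≤q′ = ℕ.≤-trans 1≤q (ℕ.m≤m+n q q′)
        ; det≡1 = ≡.trans (solveℤ 4 (λ q q′ p p′ → q ⊗ (p ⊕ p′) ⊖ (q ⊕ q′) ⊗ p ⊜ q ⊗ p′ ⊖ q′ ⊗ p) ≡.refl (+ q) (+ q′) p p′) det≡1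
        ; 0≤α  = 0≤α
        ; 0≤α′ = ≤-respʳ (sym (trans (+-cong (fromℤ-+ p p′) (-‿cong (*-congʳ (fromℕ-+ q q′))))
            (solve 5 (λ q q′ p p′ y → (p :+ p′) :- (q :+ q′) :* y := (p′ :- q′ :* y) :- (q :* y :- p))
              refl (fromℕ q) (fromℕ q′) (fromℤ p) (fromℤ p′) y))) (0≤y-x α≤α′)
        }

  -- Only the products of denominators and of errors are controlled. How they are shared between the
  -- two endpoints depends on how well `y` is approximable, which is where the irrationality measure
  -- enters.
  record IsFarey {y : ℝ} (N : ℝ) (B : Bracket y) : Set where
    open Bracket B
    field
      qq′≤N  : fromℕ q * fromℕ q′ ≤ N
      αα′N≤1 : α * α′ * N ≤ 1#

  -- Insert mediants for as long as q q′ ≤ N.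
  mediantWalk : ∀ y N → 1# ≤ N → ∃ λ (B : Bracket y) → IsFarey N B
  mediantWalk y N 1≤N = let fuel , N≤fuel = archimedean N in
      walk fuel floorBracket
        (≤-respˡ (sym 1*1≈1) 1≤N)
        (≤-trans N≤fuel (≤-by _ 0≤1 (trans (+-congʳ (+-congʳ 1*1≈1))
          (solve 2 (λ f o → (o :+ f) :- f := o) refl (fromℕ fuel) 1#))))
    where
    1*1≈1 : fromℕ 1 * fromℕ 1 ≈ 1#
    1*1≈1 = trans (*-cong fromℕ-1 fromℕ-1) (F.*-identityˡ _)

    -- The second inequality justifies the fuel: a mediant raises q q′ by the square of a positive
    -- denominator, hence by at least 1.
    walk : ∀ fuel (B : Bracket y) → let open Bracket B in
           fromℕ q * fromℕ q′ ≤ N → N ≤ fromℕ q * fromℕ q′ + fromℕ fuel →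
           ∃ λ (B : Bracket y) → IsFarey N B
    walk fuel B qq′≤N N≤ = go fuel N≤ (≤-total α′ α)
      where
      open Bracket B
      a  = fromℕ q
      a′ = fromℕ q′

      0≤aα′ = *-nonNeg (fromℕ-nonNeg q) 0≤α′
      0≤a′α = *-nonNeg (fromℕ-nonNeg q′) 0≤α
      0≤αα′ = *-nonNeg 0≤α 0≤α′

      stop : ∀ {M x} → N ≤ M → 0# ≤ x → x ≤ 1# → α * α′ * M ≈ x → ∃ λ (B : Bracket y) → IsFarey N B
      stop N≤M 0≤x x≤1 e = B , record { qq′≤N = qq′≤N ; αα′N≤1 = ≤-trans (*-monoˡ-≤ _ 0≤αα′ N≤M) (≤-trans (≤-reflexive e) x≤1) }

      product≤1 : ∀ {x z} → 0# ≤ x → 0# ≤ z → x ≤ 1# → z ≤ 1# → x * z ≤ 1#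
      product≤1 0≤x 0≤z p r = ≤-respʳ (F.*-identityˡ 1#) (*-mono-≤ 0≤x 0≤z p r)

      fuel-step : ∀ f b c → 1# ≤ c * c → b ≈ a * a′ + c * c → N ≤ a * a′ + (1# + f) → N ≤ b + f
      fuel-step f b c 1≤c² e p = ≤-trans p (≤-by _ (0≤y-x 1≤c²) (trans (+-congʳ (+-congʳ e))
        (solve 4 (λ m c f o → ((m :+ c) :+ f) :- (m :+ (o :+ f)) := c :- o) refl (a * a′) (c * c) f 1#)))

      1≤x² : ∀ {x} → 1# ≤ x → 1# ≤ x * x
      1≤x² p = ≤-respˡ (F.*-identityˡ 1#) (*-mono-≤ 0≤1 0≤1 p p)

      go : ∀ fuel → N ≤ a * a′ + fromℕ fuel → α′ ≤ α ⊎ α ≤ α′ → ∃ λ (B : Bracket y) → IsFarey N B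
      -- Without fuel N ≤ q q′, and α α′ q q′ is the product of q α′ ≤ 1 and q′ α ≤ 1.
      go zero N≤ _ = stop (≤-respʳ (F.+-identityʳ _) N≤) (*-nonNeg 0≤aα′ 0≤a′α) (product≤1 0≤aα′ 0≤a′α qα′≤1 q′α≤1)
        (solve 4 (λ a a′ α α′ → α :* α′ :* (a :* a′) := (a :* α′) :* (a′ :* α)) refl a a′ α α′)
      go (suc f) N≤ (inj₁ α′≤α) with em {fromℕ (q ℕ.+ q′) * a′ ≤ N}
      ... | yes p = walk f (mediantˡ B α′≤α) p (fuel-step (fromℕ f) _ a′ (1≤x² 1≤fromℕ-q′)
              (trans (*-congʳ (fromℕ-+ q q′)) (F.distribʳ a′ a a′)) N≤)
      -- Here N ≤ (q + q′) q′, and α α′ (q + q′) q′ = (q′ α) (q α′ + q′ α′). As α′ ≤ α, the last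
      -- factor is at most q α′ + q′ α = 1.
      ... | no ¬p = stop (≰⇒≥ ¬p) (*-nonNeg 0≤a′α 0≤s)
              (product≤1 0≤a′α 0≤s q′α≤1
                (≤-trans (+-mono-≤ ≤-refl (*-monoˡ-≤ a′ (fromℕ-nonNeg q′) α′≤α)) (≤-reflexive qα′+q′α≈1)))
              (trans (*-congˡ (*-congʳ (fromℕ-+ q q′)))
                (solve 4 (λ a a′ α α′ → α :* α′ :* ((a :+ a′) :* a′) := (a′ :* α) :* (a :* α′ :+ a′ :* α′)) refl a a′ α α′))
        where
        0≤s = +-nonNeg 0≤aα′ (*-nonNeg (fromℕ-nonNeg q′) 0≤α′)
      go (suc f) N≤ (inj₂ α≤α′) with em {a * fromℕ (q ℕ.+ q′) ≤ N}
      ... | yes p = walk f (mediantʳ B α≤α′) p (fuel-step (fromℕ f) _ a (1≤x² 1≤fromℕ-q)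
              (trans (*-congˡ (fromℕ-+ q q′)) (trans (F.distribˡ a a a′) (F.+-comm _ _))) N≤)
      ... | no ¬p = stop (≰⇒≥ ¬p) (*-nonNeg 0≤aα′ 0≤s)
              (product≤1 0≤aα′ 0≤s qα′≤1
                (≤-trans (+-mono-≤ (*-monoˡ-≤ a (fromℕ-nonNeg q) α≤α′) ≤-refl) (≤-reflexive qα′+q′α≈1)))
              (trans (*-congˡ (*-congˡ (fromℕ-+ q q′)))
                (solve 4 (λ a a′ α α′ → α :* α′ :* (a :* (a :+ a′)) := (a :* α′) :* (a :* α :+ a′ :* α)) refl a a′ α α′))
        where
        0≤s = +-nonNeg (*-nonNeg (fromℕ-nonNeg q) 0≤α) 0≤a′α

  abstract
    farey : ∀ y N → 1# ≤ N → ∃ λ (B : Bracket y) → IsFarey N B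
    farey = mediantWalk

  -- Suprema in the extended reals and absolute values.

  private module E± = AddExtremaNonStrict _≤_

  ⨆-lub : ∀ {P : Pred ℝ 0ℓ} {s} → IsUpperBound P s → ⨆ P ≤± [ s ]
  ⨆-lub {P} {s} ub with em {∃ P} | em {∃ (IsUpperBound P)}
  ... | no  _  | _      = E±.⊥±≤ _
  ... | yes _  | no ¬bd = contradiction (s , λ {x} → ub {x}) ¬bd
  ... | yes ne | yes bd = E±.[_] (proj₂ (proj₂ (complete P ne bd)) ub)

  ⨆-upper : ∀ {P : Pred ℝ 0ℓ} {s e} → IsUpperBound P s → [ e ] ≤± ⨆ P → e ≤ s
  ⨆-upper ub p = E±.[≤]-injective (E±.≤±-trans ≤-trans p (⨆-lub ub))

  ⨆-lower : ∀ {P : Pred ℝ 0ℓ} {r a} → P r → a ≤ r → [ a ] ≤± ⨆ P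
  ⨆-lower {P} {r} Pr a≤r with em {∃ P} | em {∃ (IsUpperBound P)}
  ... | no ¬ne | _      = contradiction (r , Pr) ¬ne
  ... | yes _  | no  _  = _ E±.≤⊤±
  ... | yes ne | yes bd = E±.[_] (≤-trans a≤r (proj₁ (proj₂ (complete P ne bd)) Pr))

  ⨆≈⇒upper : ∀ {P : Pred ℝ 0ℓ} {s} → ⨆ P ≈± [ s ] → IsUpperBound P s
  ⨆≈⇒upper e Pr = E±.[≤]-injective (E±.≤±-trans ≤-trans (⨆-lower Pr ≤-refl) (E±.≤±-reflexive ≤-reflexive e))

  ⨆≰⇒∃ : ∀ {P : Pred ℝ 0ℓ} {s} → ¬ ⨆ P ≤± [ s ] → ∃ λ m → P m × ¬ m ≤ s
  ⨆≰⇒∃ {P} {s} ≰ with em {∃ λ m → P m × ¬ m ≤ s}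
  ... | yes p = p
  ... | no ¬p = contradiction (⨆-lub λ {m} Pm → ≤-stable λ m≰s → ¬p (m , Pm , m≰s)) ≰

  ≼⇒∣∣≤ : ∀ {x b} → x ≼ b → ∣ x ∣ ≤ b
  ≼⇒∣∣≤ (p , q) = ⊔.⊔-lub p q

  ∣∣≤⇒≼ : ∀ {x b} → ∣ x ∣ ≤ b → x ≼ b
  ∣∣≤⇒≼ {x} p = ⊔.x⊔y≤z⇒x≤z x (- x) p , ⊔.x⊔y≤z⇒y≤z x (- x) p

  x≼∣x∣ : ∀ {x} → x ≼ ∣ x ∣
  x≼∣x∣ = ∣∣≤⇒≼ ≤-refl

  0≤∣x∣ : ∀ {x} → 0# ≤ ∣ x ∣
  0≤∣x∣ = ≼-nonNeg x≼∣x∣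

  ∣x∣≤0⇒x≈0 : ∀ {x} → ∣ x ∣ ≤ 0# → x ≈ 0#
  ∣x∣≤0⇒x≈0 {x} p = let x≤0 , -x≤0 = ∣∣≤⇒≼ p in
    ≤-antisym x≤0 (≤-by _ (0≤y-x -x≤0) (solve 1 (λ x → x :- con 0ℤ := con 0ℤ :- :- x) refl x))

  -- Roots and the lower bound given by the irrationality measure.

  pow-lipschitz : ∀ {a b} n → 0# ≤ a → a ≤ b → b ≤ 1# → b ^ᴺ n - a ^ᴺ n ≤ fromℕ n * (b - a)
  pow-lipschitz {a} {b} zero 0≤a a≤b b≤1 = ≤-reflexive (trans (F.-‿inverseʳ 1#) (sym (F.zeroˡ _)))
  pow-lipschitz {a} {b} (suc n) 0≤a a≤b b≤1 = ≤-by _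
    (+-nonNeg (+-nonNeg (0≤y-x (pow-lipschitz n 0≤a a≤b b≤1)) (*-nonNeg (0≤y-x b≤1) (0≤y-x (pow-mono n 0≤a a≤b))))
              (*-nonNeg (0≤y-x a≤b) (0≤y-x (pow≤1 n 0≤a (≤-trans a≤b b≤1)))))
    (solve 5 (λ n a b A B → (con 1ℤ :+ n) :* (b :- a) :- (b :* B :- a :* A)
       := ((n :* (b :- a) :- (B :- A)) :+ (con 1ℤ :- b) :* (B :- A)) :+ (b :- a) :* (con 1ℤ :- A))
      refl (fromℕ n) a b (a ^ᴺ n) (b ^ᴺ n))

  -- The root is the supremum of the r in [0, 1] with `r ^ᴺ suc n ≤ s`. By `pow-lipschitz` a shift
  -- of ρ by 1/(n + 1) times the error does not overshoot `s`. If the power of ρ were too large, the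
  -- shifted point would be a smaller upper bound; if too small, it would be a larger element of the
  -- set.
  root : ∀ n s → 0# ≤ s → s ≤ 1# → ∃ λ r → 0# ≤ r × r ^ᴺ suc n ≈ s
  root n s 0≤s s≤1 = ρ , 0≤ρ , ≤-antisym ρᴷ≤s s≤ρᴷ
    where
    P : Pred ℝ 0ℓ
    P r = 0# ≤ r × r ≤ 1# × r ^ᴺ suc n ≤ s
    0∈P : P 0#
    0∈P = ≤-refl , 0≤1 , ≤-respˡ (sym (F.zeroˡ _)) 0≤s
    lub = complete P (0# , 0∈P) (1# , proj₁ ∘ proj₂)
    ρ = proj₁ lub
    0≤ρ = proj₁ (proj₂ lub) 0∈P
    ρ≤1 = proj₂ (proj₂ lub) (proj₁ ∘ proj₂)
    K = fromℕ (suc n)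
    0<K = 1≤⇒0< (1≤fromℕ-suc n)
    Ki≈1 : K * K ⁻¹ ≈ 1#
    Ki≈1 = F.*-inverseʳ (0<⇒≉0 0<K)
    K[ix]≈x : ∀ x → K * (K ⁻¹ * x) ≈ x
    K[ix]≈x x = trans (sym (F.*-assoc _ _ _)) (trans (*-congʳ Ki≈1) (F.*-identityˡ x))
    ≤K*⇒ : ∀ {x z} → x ≤ K * z → K ⁻¹ * x ≤ z
    ≤K*⇒ p = *-cancelˡ-≤ 0<K (≤-respˡ (sym (K[ix]≈x _)) p)
    ix≤0⇒x≤0 : ∀ {x} → K ⁻¹ * x ≤ 0# → x ≤ 0#
    ix≤0⇒x≤0 p = ≤-respˡ (K[ix]≈x _) (≤-respʳ (F.zeroʳ K) (*-monoˡ-≤ K (proj₁ 0<K) p))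

    ρᴷ≤s : ρ ^ᴺ suc n ≤ s
    ρᴷ≤s = ≤-by _ (0≤y-x (ix≤0⇒x≤0 (≤-by _ (0≤y-x (proj₂ (proj₂ lub) {ρ - K ⁻¹ * d} ub))
        (solve 2 (λ ρ e → con 0ℤ :- e := (ρ :- e) :- ρ) refl ρ (K ⁻¹ * d)))))
        (solve 2 (λ r s → s :- r := con 0ℤ :- (r :- s)) refl (ρ ^ᴺ suc n) s)
      where
      d = ρ ^ᴺ suc n - s
      ub : IsUpperBound P (ρ - K ⁻¹ * d)
      ub {r} r∈P@(0≤r , r≤1 , rᴷ≤s) = ≤-by _ (0≤y-x (≤K*⇒ (≤-trans
          (≤-by _ (0≤y-x rᴷ≤s) (solve 3 (λ p r s → (p :- r) :- (p :- s) := s :- r) refl (ρ ^ᴺ suc n) (r ^ᴺ suc n) s))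
          (pow-lipschitz (suc n) 0≤r (proj₁ (proj₂ lub) r∈P) ρ≤1))))
        (solve 3 (λ ρ e r → (ρ :- e) :- r := (ρ :- r) :- e) refl ρ (K ⁻¹ * d) r)

    s≤ρᴷ : s ≤ ρ ^ᴺ suc n
    s≤ρᴷ with ≤-total s (ρ ^ᴺ suc n)
    ... | inj₁ p = p
    ... | inj₂ ρᴷ≤s = ≤-by _ (0≤y-x (ix≤0⇒x≤0 (≤-by _ (0≤y-x (proj₁ (proj₂ lub) (≤-trans 0≤ρ ρ≤r , r≤1 , rᴷ≤s)))
        (solve 2 (λ ρ e → con 0ℤ :- e := ρ :- (ρ :+ e)) refl ρ (K ⁻¹ * δ)))))
        (solve 2 (λ r s → r :- s := con 0ℤ :- (s :- r)) refl (ρ ^ᴺ suc n) s)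
      where
      δ = s - ρ ^ᴺ suc n
      r = ρ + K ⁻¹ * δ
      r-ρ : r - ρ ≈ K ⁻¹ * δ
      r-ρ = solve 2 (λ ρ e → (ρ :+ e) :- ρ := e) refl ρ (K ⁻¹ * δ)
      ρ≤r : ρ ≤ r
      ρ≤r = ≤-by _ (*-nonNeg (0≤x⁻¹ 0<K) (0≤y-x ρᴷ≤s)) r-ρ
      r≤1 : r ≤ 1#
      r≤1 = ≤-by _ (0≤y-x (≤K*⇒ (≤-trans
          (≤-by _ (0≤y-x s≤1) (trans (+-congʳ (+-congʳ (1^n≈1 (suc n))))
             (solve 3 (λ p s o → (o :- p) :- (s :- p) := o :- s) refl (ρ ^ᴺ suc n) s 1#)))
          (pow-lipschitz (suc n) 0≤ρ ρ≤1 ≤-refl))))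
        (solve 3 (λ ρ e o → o :- (ρ :+ e) := (o :- ρ) :- e) refl ρ (K ⁻¹ * δ) 1#)
      rᴷ≤s : r ^ᴺ suc n ≤ s
      rᴷ≤s = ≤-by _ (0≤y-x (≤-respʳ (trans (*-congˡ r-ρ) (K[ix]≈x δ)) (pow-lipschitz (suc n) 0≤ρ ρ≤r r≤1)))
        (solve 3 (λ s p r → s :- r := (s :- p) :- (r :- p)) refl s (ρ ^ᴺ suc n) (r ^ᴺ suc n))

  -- Otherwise `y` would be - u / v. Elements of `ℚ` are reduced fractions, so the gcd `g` has to be
  -- cancelled before `y` can be compared with one.
  irrational⇒vy+u≉0 : ∀ {y} → Irrational y → ∀ v u → 1 ℕ.≤ v → ¬ (fromℕ v * y + fromℤ u ≈ 0#)
  irrational⇒vy+u≉0 {y} irr v@(suc _) u _ e = irr x (*-cancelˡ-≈ d≉0 (trans dy≈n (sym d*x≈n)))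
    where
    x = (ℤ.- u) ℚ./ v
    n = fromℤ (↥ x)
    d = fromℤ (↧ x)
    g = fromℤ (gcd (ℤ.- u) (+ v))
    gn≈-u : g * n ≈ - fromℤ u
    gn≈-u = trans (F.*-comm g n) (trans (sym (fromℤ-* (↥ x) (gcd (ℤ.- u) (+ v))))
      (trans (reflexive (≡.cong fromℤ (ℚ.↥-/ (ℤ.- u) v))) (fromℤ-neg u)))
    gd≈v : g * d ≈ fromℕ v
    gd≈v = trans (F.*-comm g d) (trans (sym (fromℤ-* (↧ x) (gcd (ℤ.- u) (+ v))))
      (reflexive (≡.cong fromℤ (ℚ.↧-/ (ℤ.- u) v))))
    v≉0 = 0<⇒≉0 (1≤⇒0< (1≤fromℕ-suc (ℕ.pred v)))
    g≉0 : ¬ g ≈ 0#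
    g≉0 p = v≉0 (trans (sym gd≈v) (trans (*-congʳ p) (F.zeroˡ d)))
    d≉0 : ¬ d ≈ 0#
    d≉0 p = v≉0 (trans (sym gd≈v) (trans (*-congˡ p) (F.zeroʳ g)))
    d*x≈n : d * fromℚ x ≈ n
    d*x≈n = trans (solve 3 (λ d n i → d :* (n :* i) := (d :* i) :* n) refl d n (d ⁻¹))
      (trans (*-congʳ (F.*-inverseʳ d≉0)) (F.*-identityˡ n))
    dy≈n : d * y ≈ n
    dy≈n = *-cancelˡ-≈ g≉0 (begin
      g * (d * y)                               ≈⟨ F.*-assoc g d y ⟨
      g * d * y                                 ≈⟨ *-congʳ gd≈v ⟩
      fromℕ v * y                               ≈⟨ solve 2 (λ a b → a := (a :+ b) :- b) refl (fromℕ v * y) (fromℤ u) ⟩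
      (fromℕ v * y + fromℤ u) - fromℤ u         ≈⟨ +-congʳ e ⟩
      0# - fromℤ u                              ≈⟨ F.+-identityˡ _ ⟩
      - fromℤ u                                 ≈⟨ gn≈-u ⟨
      g * n                                     ∎)
      where open SetoidReasoning F.setoid

  module _ {A : Set} (f : A → ℝ) (P : Pred A 0ℓ) (f>0 : ∀ a → P a → 0# < f a) where

    -- Turns a finite set of exceptional approximations into a constant. Starting the minimum at 1
    -- gives `c ≤ 1#`, so that powers of `c` can later be dropped.
    positive-lower-bound : ∀ xs → ∃ λ c → 0# < c × c ≤ 1# × (∀ {a} → P a → a ∈ xs → c ≤ f a)
    positive-lower-bound [] = 1# , 1≤⇒0< ≤-refl , ≤-refl , λ _ ()
    positive-lower-bound (x ∷ xs) with positive-lower-bound xs | em {P x}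
    ... | c , 0<c , c≤1 , lb | no ¬p = c , 0<c , c≤1 , λ where
      p (here ≡.refl) → contradiction p ¬p
      p (there a∈xs)  → lb p a∈xs
    ... | c , 0<c , c≤1 , lb | yes p with ≤-total c (f x)
    ...   | inj₁ c≤fx = c , 0<c , c≤1 , λ where
      p (here ≡.refl) → c≤fx
      p (there a∈xs)  → lb p a∈xs
    ...   | inj₂ fx≤c = f x , f>0 x p , ≤-trans fx≤c c≤1 , λ where
      p (here ≡.refl) → ≤-refl
      p (there a∈xs)  → ≤-trans fx≤c (lb p a∈xs)

  -- The inequality a ≥ c v^{-(1 + 1/K)} for a = ∣ v y + u ∣, with K = 1 + k.
  irrationality-bound : ∀ {y} → Irrational y → ω y ≈± [ 1# ] → ∀ k → ∃ λ c → 0# < c × c ≤ 1# ×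
    (∀ v u {b} → 1 ℕ.≤ v → fromℕ v * y + fromℤ u ≼ b → c ^ᴺ suc k ≤ fromℕ v ^ᴺ suc (suc k) * b ^ᴺ suc k)
  irrationality-bound {y} irr ωy≈1 k = c , 0<c , c≤1 , λ v u 1≤v b →
      ≤-trans (lower-bound v u 1≤v) (*-monoˡ-≤ _ (pow-nonNeg (suc (suc k)) (fromℕ-nonNeg v)) (pow-mono (suc k) 0≤∣x∣ (≼⇒∣∣≤ b)))
    where
    K = suc k
    x : ℚ
    -- This is - (1 + 1/K), in lowest terms because consecutive integers are coprime. Its negative
    -- `w` exceeds ω(y) = 1, hence `S` is finite.
    x = mkℚ -[1+ K ] k (≡.subst (λ n → Coprimality.Coprime n K) (ℕ.+-comm K 1) (Coprimality.coprime-+ (Coprimality.1-coprimeTo K)))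
    w = - fromℚ x

    w≰1 : ¬ w ≤ 1#
    w≰1 p = ℕ.<-irrefl ≡.refl (fromℕ-cancel {suc K} {K} (≤-respˡ e (≤-respʳ (F.*-identityʳ _) (*-monoˡ-≤ (fromℕ K) (fromℕ-nonNeg K) p))))
      where
      e : fromℕ K * w ≈ fromℕ (suc K)
      e = trans (solve 3 (λ a b i → a :* :- (:- b :* i) := (a :* i) :* b) refl (fromℕ K) (fromℕ (suc K)) (fromℕ K ⁻¹))
        (trans (*-congʳ (F.*-inverseʳ (0<⇒≉0 (1≤⇒0< (1≤fromℕ-suc k))))) (F.*-identityˡ _))

    S : Pred (ℤ × ℤ) 0ℓ
    S (v , u) = ¬ (v ≡ 0ℤ) × [ ∣ fromℤ v * y + fromℤ u ∣ ] ≤± (ℤ.∣ v ∣ ^ (- w))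

    finite : Finite S
    finite with em {Finite S}
    ... | yes p = p
    ... | no ¬p = contradiction (⨆≈⇒upper ωy≈1 ¬p) w≰1

    -- The minimum is taken over v ≥ 1, where irrationality keeps the linear form away from 0; Farey
    -- denominators are of this kind.
    Positive : Pred (ℤ × ℤ) 0ℓ
    Positive (v , u) = 1ℤ ℤ.≤ v

    lower = positive-lower-bound (λ (v , u) → ∣ fromℤ v * y + fromℤ u ∣) Positive
      (λ { (+ v , u) (ℤ.+≤+ 1≤v) → 0≤∣x∣ , λ e → irrational⇒vy+u≉0 irr v u 1≤v (∣x∣≤0⇒x≈0 (≤-reflexive (sym e))) })
      (proj₁ finite)
    c = proj₁ lower
    0<c = proj₁ (proj₂ lower)
    c≤1 = proj₁ (proj₂ (proj₂ lower))
    c≤ : ∀ v u → 1 ℕ.≤ v → S (+ v , u) → c ≤ ∣ fromℕ v * y + fromℤ u ∣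
    c≤ v u 1≤v p = proj₂ (proj₂ (proj₂ lower)) {+ v , u} (ℤ.+≤+ 1≤v) (proj₂ finite {+ v , u} p)

    lower-bound : ∀ v u → 1 ℕ.≤ v → c ^ᴺ K ≤ fromℕ v ^ᴺ suc K * ∣ fromℕ v * y + fromℤ u ∣ ^ᴺ K
    lower-bound v u 1≤v with em {S (+ v , u)}
    ... | yes p = ≤-trans (pow-mono K (proj₁ 0<c) (c≤ v u 1≤v p))
        (≤-respˡ (F.*-identityˡ _) (*-mono-≤ 0≤1 (pow-nonNeg K 0≤∣x∣) (1≤pow (suc K) 1≤fv) ≤-refl))
      where
      1≤fv = ≤-respˡ fromℕ-1 (fromℕ-mono 1≤v)
    -- Outside `S` the right side is at least 1. If v^(K+1) a^K ≤ 1, then `a` is at most the Kth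
    -- root `r` of v^-(K+1); but `r` is one of the rational powers whose supremum is v^(- w), which
    -- puts the pair into `S`.
    ... | no ¬p = ≤-trans (pow≤1 K (proj₁ 0<c) c≤1) (≰⇒≥ λ vᴷ⁺¹aᴷ≤1 → ¬p (v≢0 , ⨆-lower (x , ≤-reflexive (sym (-‿involutive _)) , 0<r , rᴷ≈s)
          (pow-cancel-≤ k 0≤∣x∣ 0≤r (≤-respʳ (sym rᴷ≈s) (*-cancelˡ-≤ 0<vᴷ⁺¹ (≤-respʳ (sym vᴷ⁺¹s≈1) vᴷ⁺¹aᴷ≤1))))))
      where
      1≤fv = ≤-respˡ fromℕ-1 (fromℕ-mono 1≤v)
      0<vᴷ⁺¹ = 1≤⇒0< (1≤pow (suc K) 1≤fv)
      s = (fromℕ v ^ᴺ suc K) ⁻¹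
      vᴷ⁺¹s≈1 : fromℕ v ^ᴺ suc K * s ≈ 1#
      vᴷ⁺¹s≈1 = F.*-inverseʳ (0<⇒≉0 0<vᴷ⁺¹)
      s≤1 : s ≤ 1#
      s≤1 = *-cancelˡ-≤ 0<vᴷ⁺¹ (≤-respˡ (sym vᴷ⁺¹s≈1) (≤-respʳ (sym (F.*-identityʳ _)) (1≤pow (suc K) 1≤fv)))
      rootOf-s = root k s (0≤x⁻¹ 0<vᴷ⁺¹) s≤1
      r = proj₁ rootOf-s
      0≤r = proj₁ (proj₂ rootOf-s)
      rᴷ≈s = proj₂ (proj₂ rootOf-s)
      0<r : 0# < r
      0<r = 0≤r , λ 0≈r → F.0≉1 (trans (sym (F.zeroʳ _)) (trans (*-congˡ (trans (sym (trans (*-congʳ (sym 0≈r)) (F.zeroˡ _))) rᴷ≈s)) vᴷ⁺¹s≈1))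
      v≢0 : ¬ (+ v ≡ 0ℤ)
      v≢0 ≡.refl = contradiction 1≤v λ ()

  module _ {c : ℝ} (0<c : 0# < c) (c≤1 : c ≤ 1#) (k : ℕ) {Z z : ℝ} (1≤Z : 1# ≤ Z) (0≤z : 0# ≤ z) (Zz≈1 : Z * z ≈ 1#) where
    private
      K = suc k
      0≤Z = ≤-trans 0≤1 1≤Z
      0≤c = proj₁ 0<c

      z≤1 : z ≤ 1#
      z≤1 = *-cancelˡ-≤ (1≤⇒0< 1≤Z) (≤-respˡ (sym Zz≈1) (≤-respʳ (sym (F.*-identityʳ Z)) 1≤Z))

      Zⁿzⁿ≈1 : ∀ n → Z ^ᴺ n * z ^ᴺ n ≈ 1#
      Zⁿzⁿ≈1 n = trans (sym (^-distrib-* Z z n)) (trans (^-congˡ n Zz≈1) (1^n≈1 n))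

      -- Multiplying the lower bound for `α′` by w^(2K+1) splits it into powers of a′ w and w α′.
      -- For w = a and for w = α both products are bounded by the Farey inequalities.
      powers : ∀ {a′ α′ w} → 0# ≤ a′ → 0# ≤ α′ → 0# ≤ w → c ^ᴺ K ≤ a′ ^ᴺ suc K * α′ ^ᴺ K →
               (c * w) ^ᴺ (K ℕ.+ suc K) ≤ (a′ * w) ^ᴺ suc K * (w * α′) ^ᴺ K
      powers {a′} {α′} {w} 0≤a′ 0≤α′ 0≤w p = begin
        (c * w) ^ᴺ (K ℕ.+ suc K)                                ≈⟨ trans (^-homo-* (c * w) K (suc K)) (*-congʳ (^-distrib-* c w K)) ⟩
        (c ^ᴺ K * w ^ᴺ K) * (c * w) ^ᴺ suc K                    ≤⟨ *-mono-≤ (*-nonNeg (pow-nonNeg K 0≤c) (pow-nonNeg K 0≤w)) (pow-nonNeg (suc K) (*-nonNeg 0≤c 0≤w))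
                                                                     (*-mono-≤ (pow-nonNeg K 0≤c) (pow-nonNeg K 0≤w) p ≤-refl)
                                                                     (pow-mono (suc K) (*-nonNeg 0≤c 0≤w) (≤-respʳ (F.*-identityˡ w) (*-mono-≤ 0≤c 0≤w c≤1 ≤-refl))) ⟩
        ((a′ ^ᴺ suc K * α′ ^ᴺ K) * w ^ᴺ K) * w ^ᴺ suc K         ≈⟨ solve 4 (λ x y u v → ((x :* y) :* u) :* v := (x :* v) :* (u :* y)) refl (a′ ^ᴺ suc K) (α′ ^ᴺ K) (w ^ᴺ K) (w ^ᴺ suc K) ⟩
        (a′ ^ᴺ suc K * w ^ᴺ suc K) * (w ^ᴺ K * α′ ^ᴺ K)         ≈⟨ *-cong (^-distrib-* a′ w (suc K)) (^-distrib-* w α′ K) ⟨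
        (a′ * w) ^ᴺ suc K * (w * α′) ^ᴺ K                       ∎
        where open ≤-Reasoning

    -- A lower bound for α′ in terms of a′ makes both q q′ ≤ N and α α′ N ≤ 1
    -- nearly balanced.
    balanced : ∀ {a a′ α α′} → 0# ≤ a → 0# ≤ a′ → 0# ≤ α → 0# ≤ α′ →
               c ^ᴺ K ≤ a′ ^ᴺ suc K * α′ ^ᴺ K →
               a * a′ ≤ Z ^ᴺ (K ℕ.+ K) → α * α′ * Z ^ᴺ (K ℕ.+ K) ≤ 1# → a * α′ ≤ 1# → a′ * α ≤ 1# →
               c * a ≤ Z ^ᴺ suc K × c * α ≤ z ^ᴺ k
    balanced {a} {a′} {α} {α′} 0≤a 0≤a′ 0≤α 0≤α′ p aa′≤N αα′N≤1 aα′≤1 a′α≤1 =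
      pow-cancel-≤ (k ℕ.+ suc K) (*-nonNeg 0≤c 0≤a) (pow-nonNeg (suc K) 0≤Z) (begin
        (c * a) ^ᴺ (K ℕ.+ suc K)              ≤⟨ powers 0≤a′ 0≤α′ 0≤a p ⟩
        (a′ * a) ^ᴺ suc K * (a * α′) ^ᴺ K     ≤⟨ *-mono-≤ (pow-nonNeg (suc K) (*-nonNeg 0≤a′ 0≤a)) (pow-nonNeg K (*-nonNeg 0≤a 0≤α′))
                                                   (pow-mono (suc K) (*-nonNeg 0≤a′ 0≤a) (≤-respˡ (F.*-comm a a′) aa′≤N))
                                                   (pow≤1 K (*-nonNeg 0≤a 0≤α′) aα′≤1) ⟩
        (Z ^ᴺ (K ℕ.+ K)) ^ᴺ suc K * 1#        ≈⟨ trans (F.*-identityʳ _) (^-assocʳ Z (K ℕ.+ K) (suc K)) ⟩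
        -- The true exponents are 2K(K+1)/(2K+1) = K + K/(2K+1) here and 2K²/(2K+1) = K - K/(2K+1)
        -- below. They are rounded to K + 1 and to k = K - 1, at the cost of less than one factor Z
        -- each.
        Z ^ᴺ ((K ℕ.+ K) ℕ.* suc K)            ≤⟨ pow-monoʳ 1≤Z (ℕ.≤-trans (ℕ.≤-reflexive (ℕ.*-comm (K ℕ.+ K) (suc K))) (ℕ.*-monoʳ-≤ (suc K) (ℕ.+-monoʳ-≤ K (ℕ.n≤1+n K)))) ⟩
        Z ^ᴺ (suc K ℕ.* (K ℕ.+ suc K))        ≈⟨ ^-assocʳ Z (suc K) (K ℕ.+ suc K) ⟨
        (Z ^ᴺ suc K) ^ᴺ (K ℕ.+ suc K)         ∎) ,
      pow-cancel-≤ (k ℕ.+ suc K) (*-nonNeg 0≤c 0≤α) (pow-nonNeg k 0≤z) (begin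
        (c * α) ^ᴺ (K ℕ.+ suc K)              ≤⟨ powers 0≤a′ 0≤α′ 0≤α p ⟩
        (a′ * α) ^ᴺ suc K * (α * α′) ^ᴺ K     ≤⟨ *-mono-≤ (pow-nonNeg (suc K) (*-nonNeg 0≤a′ 0≤α)) (pow-nonNeg K (*-nonNeg 0≤α 0≤α′))
                                                   (pow≤1 (suc K) (*-nonNeg 0≤a′ 0≤α) a′α≤1)
                                                   (pow-mono K (*-nonNeg 0≤α 0≤α′) αα′≤z²ᴷ) ⟩
        1# * (z ^ᴺ (K ℕ.+ K)) ^ᴺ K            ≈⟨ trans (F.*-identityˡ _) (^-assocʳ z (K ℕ.+ K) K) ⟩
        z ^ᴺ ((K ℕ.+ K) ℕ.* K)                ≤⟨ pow-antiʳ 0≤z z≤1 k[2K+1]≤2K² ⟩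
        z ^ᴺ (k ℕ.* (K ℕ.+ suc K))            ≈⟨ ^-assocʳ z k (K ℕ.+ suc K) ⟨
        (z ^ᴺ k) ^ᴺ (K ℕ.+ suc K)             ∎)
      where
      open ≤-Reasoning
      αα′≤z²ᴷ : α * α′ ≤ z ^ᴺ (K ℕ.+ K)
      αα′≤z²ᴷ = *-cancelˡ-≤ (1≤⇒0< (1≤pow (K ℕ.+ K) 1≤Z)) (≤-respˡ (F.*-comm _ _) (≤-respʳ (sym (Zⁿzⁿ≈1 (K ℕ.+ K))) αα′N≤1))
      k[2K+1]≤2K² : k ℕ.* (K ℕ.+ suc K) ℕ.≤ (K ℕ.+ K) ℕ.* K
      k[2K+1]≤2K² = ℕ.≤-trans (ℕ.m≤m+n _ (k ℕ.+ 2)) (ℕ.≤-reflexive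
        (ℕSolver.solve 1 (λ k → k ℕ:* ((one ℕ:+ k) ℕ:+ (one ℕ:+ (one ℕ:+ k))) ℕ:+ (k ℕ:+ ℕSolver.con 2)
          ℕ:= ((one ℕ:+ k) ℕ:+ (one ℕ:+ k)) ℕ:* (one ℕ:+ k)) ≡.refl k))
        where
        open ℕSolver using () renaming (_:+_ to _ℕ:+_; _:*_ to _ℕ:*_; _:=_ to _ℕ:=_)
        one : ∀ {n} → ℕSolver.Polynomial n
        one = ℕSolver.con 1

  -- Counting matrices of determinant 1 with bounded columns.

  integersUpTo : ℕ → List ℤ
  integersUpTo X = map +_ (upTo (suc X)) ++ map -[1+_] (upTo X)

  length-integersUpTo : ∀ X → length (integersUpTo X) ≡ 1 ℕ.+ 2 ℕ.* X
  length-integersUpTo X = ≡.trans (List.length-++ (map +_ (upTo (suc X))))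
    (≡.trans (≡.cong₂ ℕ._+_ (≡.trans (List.length-map +_ (upTo (suc X))) (List.length-upTo (suc X)))
                             (≡.trans (List.length-map -[1+_] (upTo X)) (List.length-upTo X)))
      (≡.cong (λ n → suc (X ℕ.+ n)) (≡.sym (ℕ.+-identityʳ X))))

  ∈-integersUpTo : ∀ {X} i → ℤ.∣ i ∣ ℕ.≤ X → i ∈ integersUpTo X
  ∈-integersUpTo (+ n)    n≤X = List.∈-++⁺ˡ (List.∈-map⁺ +_ (List.∈-upTo⁺ (ℕ.s≤s n≤X)))
  ∈-integersUpTo -[1+ n ] n<X = List.∈-++⁺ʳ _ (List.∈-map⁺ -[1+_] (List.∈-upTo⁺ n<X))

  rows : ℕ → ℕ → List (ℤ × ℤ)
  rows X Y = cartesianProductWith _,_ (integersUpTo X) (integersUpTo Y)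

  ∈-rows : ∀ {X Y a b} → ℤ.∣ a ∣ ℕ.≤ X → ℤ.∣ b ∣ ℕ.≤ Y → (a , b) ∈ rows X Y
  ∈-rows {a = a} {b} a≤X b≤Y = List.∈-cartesianProductWith⁺ _,_ (∈-integersUpTo a a≤X) (∈-integersUpTo b b≤Y)

  length-concatMap-≤ : ∀ {A B : Set} (f : A → List B) k → (∀ x → length (f x) ℕ.≤ k) →
                       ∀ xs → length (concatMap f xs) ℕ.≤ length xs ℕ.* k
  length-concatMap-≤ f k f≤k []       = ℕ.z≤n
  length-concatMap-≤ f k f≤k (x ∷ xs) = ℕ.≤-trans (ℕ.≤-reflexive (List.length-++ (f x)))
    (ℕ.+-mono-≤ (f≤k x) (length-concatMap-≤ f k f≤k xs))

  length-cartesianProductWith : ∀ {A B C : Set} (f : A → B → C) xs ys →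
                                length (cartesianProductWith f xs ys) ≡ length xs ℕ.* length ys
  length-cartesianProductWith f []       ys = ≡.refl
  length-cartesianProductWith f (x ∷ xs) ys = ≡.trans (List.length-++ (map (f x) ys))
    (≡.cong₂ ℕ._+_ (List.length-map (f x) ys) (length-cartesianProductWith f xs ys))

  private
    Completes : ℤ → ℤ → Pred (ℤ × ℤ) 0ℓ
    Completes a b (c , d) = a ℤ.* d ℤ.- b ℤ.* c ≡ 1ℤ × ℤ.∣ c ∣ ℕ.≤ ℤ.∣ a ∣

    shear : ℤ → ℤ → ℤ × ℤ → ℤ → ℤ × ℤ
    shear a b (c , d) j = c ℤ.+ j ℤ.* a , d ℤ.+ j ℤ.* b

    completions : ℤ × ℤ → List (ℤ × ℤ)
    completions (a , b) with em {∃ (Completes a b)}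
    ... | yes (cd , _) = map (shear a b cd) (integersUpTo 2)
    ... | no  _        = []

    length-completions : ∀ ab → length (completions ab) ℕ.≤ 5
    length-completions (a , b) with em {∃ (Completes a b)}
    ... | yes (cd , _) = ℕ.≤-reflexive (List.length-map (shear a b cd) (integersUpTo 2))
    ... | no  _        = ℕ.z≤n

    -- Two completions differ by a multiple j of the given row, and ∣ j ∣ ≤ 2
    -- because ∣ j a ∣ ≤ 2 ∣ a ∣.
    Completes⇒shear : ∀ {a b cd cd′} → Completes a b cd → Completes a b cd′ →
                      ∃ λ j → cd′ ≡ shear a b cd j × ℤ.∣ j ∣ ℕ.≤ 2
    Completes⇒shear {a} {b} {c , d} {c′ , d′} (det , c≤a) (det′ , c′≤a) =
      j , ≡.cong₂ _,_ c′≡ d′≡ , j≤2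
      where
      open ≡.≡-Reasoning
      open ℤSolver using () renaming (solve to solveℤ; _:=_ to _⊜_; _:+_ to _⊕_; _:*_ to _⊗_; _:-_ to _⊖_)
      -- Cramer's rule in the basis (a , b), (c , d): `j` is the coordinate of (c′ , d′) along (a ,
      -- b), and the other coordinate is a d′ - b c′ = 1.
      j = d ℤ.* c′ ℤ.- c ℤ.* d′

      c′≡ : c′ ≡ c ℤ.+ j ℤ.* a
      c′≡ = begin
        c′ ≡⟨ solveℤ 2 (λ c c′ → c′ ⊜ c′ ⊗ ℤSolver.con 1ℤ ⊕ c ⊖ c ⊗ ℤSolver.con 1ℤ) ≡.refl c c′ ⟩
        c′ ℤ.* 1ℤ ℤ.+ c ℤ.- c ℤ.* 1ℤ ≡⟨ ≡.cong₂ (λ u v → c′ ℤ.* u ℤ.+ c ℤ.- c ℤ.* v) det det′ ⟨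
        c′ ℤ.* (a ℤ.* d ℤ.- b ℤ.* c) ℤ.+ c ℤ.- c ℤ.* (a ℤ.* d′ ℤ.- b ℤ.* c′)
          ≡⟨ solveℤ 6 (λ a b c d c′ d′ → c′ ⊗ (a ⊗ d ⊖ b ⊗ c) ⊕ c ⊖ c ⊗ (a ⊗ d′ ⊖ b ⊗ c′) ⊜ c ⊕ (d ⊗ c′ ⊖ c ⊗ d′) ⊗ a) ≡.refl a b c d c′ d′ ⟩
        c ℤ.+ j ℤ.* a ∎

      d′≡ : d′ ≡ d ℤ.+ j ℤ.* b
      d′≡ = begin
        d′ ≡⟨ solveℤ 2 (λ d d′ → d′ ⊜ d′ ⊗ ℤSolver.con 1ℤ ⊕ d ⊖ d ⊗ ℤSolver.con 1ℤ) ≡.refl d d′ ⟩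
        d′ ℤ.* 1ℤ ℤ.+ d ℤ.- d ℤ.* 1ℤ ≡⟨ ≡.cong₂ (λ u v → d′ ℤ.* u ℤ.+ d ℤ.- d ℤ.* v) det det′ ⟨
        d′ ℤ.* (a ℤ.* d ℤ.- b ℤ.* c) ℤ.+ d ℤ.- d ℤ.* (a ℤ.* d′ ℤ.- b ℤ.* c′)
          ≡⟨ solveℤ 6 (λ a b c d c′ d′ → d′ ⊗ (a ⊗ d ⊖ b ⊗ c) ⊕ d ⊖ d ⊗ (a ⊗ d′ ⊖ b ⊗ c′) ⊜ d ⊕ (d ⊗ c′ ⊖ c ⊗ d′) ⊗ b) ≡.refl a b c d c′ d′ ⟩
        d ℤ.+ j ℤ.* b ∎

      a≢0 : ¬ ℤ.∣ a ∣ ≡ 0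
      a≢0 ∣a∣≡0 with ℤ.∣i∣≡0⇒i≡0 {a} ∣a∣≡0 | ℤ.∣i∣≡0⇒i≡0 {c} (ℕ.n≤0⇒n≡0 (≡.subst (ℤ.∣ c ∣ ℕ.≤_) ∣a∣≡0 c≤a))
      ... | ≡.refl | ≡.refl with () ← ≡.trans (≡.sym det) (≡.cong (λ n → 0ℤ ℤ.- n) (ℤ.*-zeroʳ b))

      ja≡c′-c : j ℤ.* a ≡ c′ ℤ.- c
      ja≡c′-c = ≡.sym (≡.trans (≡.cong (ℤ._- c) c′≡) (solveℤ 2 (λ c e → c ⊕ e ⊖ c ⊜ e) ≡.refl c (j ℤ.* a)))

      j≤2 : ℤ.∣ j ∣ ℕ.≤ 2
      j≤2 = ℕ.*-cancelʳ-≤ ℤ.∣ j ∣ 2 ℤ.∣ a ∣ {{ℕ.≢-nonZero a≢0}} (ℕ.≤-trans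
        (ℕ.≤-reflexive (≡.trans (≡.sym (ℤ.abs-* j a)) (≡.cong ℤ.∣_∣ ja≡c′-c)))
        (ℕ.≤-trans (ℤ.∣i-j∣≤∣i∣+∣j∣ c′ c) (ℕ.≤-trans (ℕ.+-mono-≤ c′≤a c≤a)
          (ℕ.≤-reflexive (≡.cong (ℤ.∣ a ∣ ℕ.+_) (≡.sym (ℕ.+-identityʳ _)))))))

    ∈-completions : ∀ a b cd → Completes a b cd → cd ∈ completions (a , b)
    ∈-completions a b cd p with em {∃ (Completes a b)}
    ... | no ¬∃ = contradiction (cd , p) ¬∃
    ... | yes (cd₀ , p₀) = let j , e , j≤2 = Completes⇒shear {a} {b} {cd₀} {cd} p₀ p in
      ≡.subst (_∈ map (shear a b cd₀) (integersUpTo 2)) (≡.sym e) (List.∈-map⁺ (shear a b cd₀) (∈-integersUpTo j j≤2))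

    -- The signs keep the determinant equal to 1 when the given row comes second.
    bothOrders : ℤ × ℤ → ℤ × ℤ → List (Matrix₂ ℤ)
    bothOrders (a , b) (c , d) = matrix a b c d ∷ matrix (ℤ.- c) (ℤ.- d) a b ∷ []

    withRow : ℤ × ℤ → List (Matrix₂ ℤ)
    withRow ab = concatMap (bothOrders ab) (completions ab)

  private
    1+2n≤3n : ∀ n → 1 ℕ.+ 2 ℕ.* suc n ℕ.≤ 3 ℕ.* suc n
    1+2n≤3n n = ℕ.+-monoˡ-≤ (2 ℕ.* suc n) (ℕ.s≤s (ℕ.z≤n {n}))

  abstract
    -- The row whose first entry is larger determines the other one up to five
    -- possibilities.
    boundedSL₂ℤ : ∀ X Y → ∃ λ (γs : List (Matrix₂ ℤ)) → length γs ℕ.≤ 90 ℕ.* (X ℕ.* Y) ×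
      (∀ γ → SL₂ℤ γ → ℤ.∣ a₁₁ γ ∣ ℕ.≤ X → ℤ.∣ a₁₂ γ ∣ ℕ.≤ Y → ℤ.∣ a₂₁ γ ∣ ℕ.≤ X → ℤ.∣ a₂₂ γ ∣ ℕ.≤ Y → γ ∈ γs)
    -- A column bounded by 0 makes the determinant vanish. So the count is a multiple of X Y with no
    -- additive term, which matters when one of the bounds is tiny.
    boundedSL₂ℤ zero Y = [] , ℕ.z≤n , λ (matrix a b c d) det a≤0 _ c≤0 _ →
      ⊥-elim (0≢1 b d (ℤ.∣i∣≡0⇒i≡0 {a} (ℕ.n≤0⇒n≡0 a≤0)) (ℤ.∣i∣≡0⇒i≡0 {c} (ℕ.n≤0⇒n≡0 c≤0)) det)
      where
      0≢1 : ∀ {a c} b d → a ≡ 0ℤ → c ≡ 0ℤ → ¬ SL₂ℤ (matrix a b c d)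
      0≢1 b d ≡.refl ≡.refl det with () ← ≡.trans (≡.sym det) (≡.cong (λ n → 0ℤ ℤ.- n) (ℤ.*-zeroʳ b))
    boundedSL₂ℤ X@(suc _) zero = [] , ℕ.z≤n , λ (matrix a b c d) det _ b≤0 _ d≤0 →
      ⊥-elim (0≢1 a c (ℤ.∣i∣≡0⇒i≡0 {b} (ℕ.n≤0⇒n≡0 b≤0)) (ℤ.∣i∣≡0⇒i≡0 {d} (ℕ.n≤0⇒n≡0 d≤0)) det)
      where
      0≢1 : ∀ {b d} a c → b ≡ 0ℤ → d ≡ 0ℤ → ¬ SL₂ℤ (matrix a b c d)
      0≢1 a c ≡.refl ≡.refl det with () ← ≡.trans (≡.sym det) (≡.cong (ℤ._- 0ℤ) (ℤ.*-zeroʳ a))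
    boundedSL₂ℤ X@(suc m) Y@(suc n) = concatMap withRow (rows X Y) , length≤ , λ (matrix a b c d) → complete′ a b c d
      where
      length-withRow : ∀ ab → length (withRow ab) ℕ.≤ 10
      length-withRow ab = ℕ.≤-trans (length-concatMap-≤ (bothOrders ab) 2 (λ _ → ℕ.≤-refl) (completions ab))
        (ℕ.*-monoˡ-≤ 2 (length-completions ab))

      length-rows : length (rows X Y) ≡ (1 ℕ.+ 2 ℕ.* X) ℕ.* (1 ℕ.+ 2 ℕ.* Y)
      length-rows = ≡.trans (length-cartesianProductWith _,_ (integersUpTo X) (integersUpTo Y))
        (≡.cong₂ ℕ._*_ (length-integersUpTo X) (length-integersUpTo Y))

      -- 90 = 3 · 3 · 5 · 2: at most 3 X and 3 Y values for the entries of the row, five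
      -- completions, two orders of the rows.
      length≤ : length (concatMap withRow (rows X Y)) ℕ.≤ 90 ℕ.* (X ℕ.* Y)
      length≤ = begin
        length (concatMap withRow (rows X Y))             ≤⟨ length-concatMap-≤ withRow 10 length-withRow (rows X Y) ⟩
        length (rows X Y) ℕ.* 10                          ≡⟨ ≡.cong (ℕ._* 10) length-rows ⟩
        (1 ℕ.+ 2 ℕ.* X) ℕ.* (1 ℕ.+ 2 ℕ.* Y) ℕ.* 10        ≤⟨ ℕ.*-monoˡ-≤ 10 (ℕ.*-mono-≤ (1+2n≤3n m) (1+2n≤3n n)) ⟩
        3 ℕ.* X ℕ.* (3 ℕ.* Y) ℕ.* 10                      ≡⟨ ℕSolver.solve 2 (λ x y → ℕSolver.con 3 ℕ:* x ℕ:* (ℕSolver.con 3 ℕ:* y) ℕ:* ℕSolver.con 10 ℕ:= ℕSolver.con 90 ℕ:* (x ℕ:* y)) ≡.refl X Y ⟩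
        90 ℕ.* (X ℕ.* Y)                                  ∎
        where
        open ℕ.≤-Reasoning
        open ℕSolver using () renaming (_:*_ to _ℕ:*_; _:=_ to _ℕ:=_)

      ∈-withRows : ∀ {a b cd γ} → ℤ.∣ a ∣ ℕ.≤ X → ℤ.∣ b ∣ ℕ.≤ Y → Completes a b cd → γ ∈ bothOrders (a , b) cd →
                   γ ∈ concatMap withRow (rows X Y)
      ∈-withRows {a} {b} {cd} a≤X b≤Y p γ∈ = List.∈-concatMap⁺ withRow (List.lose
        (∈-rows a≤X b≤Y)
        (List.∈-concatMap⁺ (bothOrders (a , b)) (List.lose (∈-completions a b cd p) γ∈)))

      complete′ : ∀ a b c d → SL₂ℤ (matrix a b c d) → ℤ.∣ a ∣ ℕ.≤ X → ℤ.∣ b ∣ ℕ.≤ Y → ℤ.∣ c ∣ ℕ.≤ X → ℤ.∣ d ∣ ℕ.≤ Y →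
                  matrix a b c d ∈ concatMap withRow (rows X Y)
      complete′ a b c d det a≤X b≤Y c≤X d≤Y with ℕ.≤-total ℤ.∣ c ∣ ℤ.∣ a ∣
      ... | inj₁ c≤a = ∈-withRows a≤X b≤Y (det , c≤a) (here ≡.refl)
      ... | inj₂ a≤c = ∈-withRows {cd = ℤ.- a , ℤ.- b} c≤X d≤Y
            (≡.trans (solveℤ 4 (λ a b c d → c ⊗ (⊝ b) ⊖ d ⊗ (⊝ a) ⊜ a ⊗ d ⊖ b ⊗ c) ≡.refl a b c d) det ,
             ℕ.≤-trans (ℕ.≤-reflexive (ℤ.∣-i∣≡∣i∣ a)) a≤c)
            (there (here (≡.cong₂ (λ a b → matrix a b c d) (≡.sym (ℤ.neg-involutive a)) (≡.sym (ℤ.neg-involutive b)))))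
        where
        open ℤSolver using () renaming (solve to solveℤ; _:=_ to _⊜_; _:*_ to _⊗_; _:-_ to _⊖_; :-_ to ⊝_)

  -- Scales and the size of the entries after both changes of basis.

  module Scales (l : ℕ) where

    -- Z runs over the powers of 2, U = Zˡ, and ∥ γ ∥ has order T = (U Z)⁴;
    -- z and u are the inverses of Z and U.
    record Scale : Set where
      field
        Z z  : ℝ
        1≤Z  : 1# ≤ Z
        0≤z  : 0# ≤ z
        Zz≈1 : Z * z ≈ 1#

      U u T ρ : ℝ
      U = Z ^ᴺ l
      u = z ^ᴺ l
      T = (U ^ᴺ 4) * (Z ^ᴺ 4)
      ρ = (u ^ᴺ 2) * (z ^ᴺ 6)

      0≤Z = ≤-trans 0≤1 1≤Z
      1≤U = 1≤pow l 1≤Z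
      0≤U = ≤-trans 0≤1 1≤U
      0≤u = pow-nonNeg l 0≤z

      Uu≈1 : U * u ≈ 1#
      Uu≈1 = trans (sym (^-distrib-* Z z l)) (trans (^-congˡ l Zz≈1) (1^n≈1 l))

      z≤1 : z ≤ 1#
      z≤1 = *-cancelˡ-≤ (1≤⇒0< 1≤Z) (≤-respˡ (sym Zz≈1) (≤-respʳ (sym (F.*-identityʳ Z)) 1≤Z))

      u≤1 : u ≤ 1#
      u≤1 = pow≤1 l 0≤z z≤1

      -- The ring solver does not know that U u = Z z = 1. Identities are therefore proved with
      -- these products inserted, and they are removed here.
      cancel : ∀ i j x → x * ((U * u) ^ᴺ i * (Z * z) ^ᴺ j) ≈ x
      cancel i j x = trans (*-congˡ (*-cong (trans (^-congˡ i Uu≈1) (1^n≈1 i)) (trans (^-congˡ j Zz≈1) (1^n≈1 j))))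
        (trans (*-congˡ (F.*-identityˡ 1#)) (F.*-identityʳ x))

      xy≤x : ∀ {x y} → 0# ≤ x → y ≤ 1# → x * y ≤ x
      xy≤x 0≤x y≤1 = ≤-respʳ (F.*-identityʳ _) (*-monoˡ-≤ _ 0≤x y≤1)

      0≤U² = pow-nonNeg 2 0≤U
      z²≤1 = pow≤1 2 0≤z z≤1

      Tρ≤U² : T * ρ ≤ U ^ᴺ 2
      Tρ≤U² = ≤-respˡ (trans (sym (cancel 2 4 _)) (solve 4 (λ U u Z z → (U :^ 2 :* z :^ 2) :* ((U :* u) :^ 2 :* (Z :* z) :^ 4)
        := (U :^ 4 :* Z :^ 4) :* (u :^ 2 :* z :^ 6)) refl U u Z z)) (xy≤x 0≤U² z²≤1)

      1≤T : 1# ≤ T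
      1≤T = ≤-respˡ (F.*-identityˡ 1#) (*-mono-≤ 0≤1 0≤1 (1≤pow 4 1≤U) (1≤pow 4 1≤Z))

      0≤ρ : 0# ≤ ρ
      0≤ρ = *-nonNeg (pow-nonNeg 2 0≤u) (pow-nonNeg 6 0≤z)

      ρ≤1 : ρ ≤ 1#
      ρ≤1 = ≤-trans (xy≤x (pow-nonNeg 2 0≤u) (pow≤1 6 0≤z z≤1)) (pow≤1 2 0≤u u≤1)

      -- Q = T^(1/4) Z³ will bound the rows of `h`, and W = T^(3/4) Z the first column of `h γ`. In
      -- the same terms u = T^(-1/4) Z and ρ = T^(-1/2) Z^-4.
      Q W : ℝ
      Q = U * (Z ^ᴺ 4)
      W = (U ^ᴺ 3) * (Z ^ᴺ 4)

      QU²≤W : Q * U ^ᴺ 2 ≤ W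
      QU²≤W = ≤-reflexive (solve 2 (λ U Z → (U :* Z :^ 4) :* U :^ 2 := U :^ 3 :* Z :^ 4) refl U Z)

      uT≤W : u * T ≤ W
      uT≤W = ≤-reflexive (trans (solve 4 (λ U u Z z → u :* (U :^ 4 :* Z :^ 4) := (U :^ 3 :* Z :^ 4) :* ((U :* u) :^ 1 :* (Z :* z) :^ 0)) refl U u Z z) (cancel 1 0 W))

      Qρ≤u : Q * ρ ≤ u
      Qρ≤u = ≤-respˡ (trans (sym (cancel 1 4 _)) (solve 4 (λ U u Z z → (u :* z :^ 2) :* ((U :* u) :^ 1 :* (Z :* z) :^ 4)
        := (U :* Z :^ 4) :* (u :^ 2 :* z :^ 6)) refl U u Z z)) (xy≤x 0≤u z²≤1)

      uρ≤u : u * ρ ≤ u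
      uρ≤u = xy≤x 0≤u ρ≤1

  module Reduction (l : ℕ) (x₁ x₂ y D A : ℝ) where
    open Scales l public
    open Scale

    -- v and w are the columns of γ, and t the scalar for which γ x is within
    -- ρ of t • (y , 1).
    record Config (S : Scale) : Set where
      field
        v₁ w₁ v₂ w₂ t t⁻¹ : ℝ
        det≈1 : v₁ * w₂ - w₁ * v₂ ≈ 1#
        tt⁻¹≈1 : t * t⁻¹ ≈ 1#
        t≼ : t ≼ A
        t⁻¹≼ : t⁻¹ ≼ A
        v₁≼ : Big-O v₁ D (T S)
        v₂≼ : Big-O v₂ D (T S)
        e₁≼ : v₁ * x₁ + w₁ * x₂ - t * y ≼ ρ S
        e₂≼ : v₂ * x₁ + w₂ * x₂ - t ≼ ρ S

      e₁ e₂ : ℝ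
      e₁ = v₁ * x₁ + w₁ * x₂ - t * y
      e₂ = v₂ * x₁ + w₂ * x₂ - t

    open Config

    private
      O-const : ∀ {x b g} → x ≼ b → 1# ≤ g → Big-O x b g
      O-const p 1≤g = O-weaken (big-O (≼-nonNeg p) (≼-trans p (≤-reflexive (sym (F.*-identityʳ _))))) 1≤g

      O-1 : ∀ {x g} → x ≼ g → Big-O x 1# g
      O-1 p = big-O 0≤1 (≼-trans p (≤-reflexive (sym (F.*-identityˡ _))))

      cancel-t : ∀ t t⁻¹ x y → t * t⁻¹ ≈ 1# → t * x ≈ y → t⁻¹ * y ≈ x
      cancel-t t t⁻¹ x y e p = trans (*-congˡ (sym p)) (trans (solve 3 (λ t s x → s :* (t :* x) := (t :* s) :* x) refl t t⁻¹ x)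
        (trans (*-congʳ e) (F.*-identityˡ x)))

    -- det γ = 1 turns t (v₁ - y v₂) into x₂ plus error terms.
    column : ∃ λ C → ∀ {S} (c : Config S) → Big-O (v₁ c - y * v₂ c) C (U S ^ᴺ 2)
    column = _ , λ {S} c →
      O-resp (cancel-t (t c) (t⁻¹ c) _ _ (tt⁻¹≈1 c) (trans
        (solve 8 (λ v₁ w₁ v₂ w₂ x₁ x₂ y t → t :* (v₁ :- y :* v₂) :=
            (v₁ :* w₂ :- w₁ :* v₂) :* x₂ :+ v₂ :* (v₁ :* x₁ :+ w₁ :* x₂ :- t :* y) :- v₁ :* (v₂ :* x₁ :+ w₂ :* x₂ :- t))
          refl (v₁ c) (w₁ c) (v₂ c) (w₂ c) x₁ x₂ y (t c))
        (+-congʳ (+-congʳ (trans (*-congʳ (det≈1 c)) (F.*-identityˡ x₂))))))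
      (O-scale (O-+ (O-+ (O-const (x≼∣x∣ {x₂}) (1≤pow 2 (1≤U S)))
                         (O-weaken (O-* (v₂≼ c) (O-1 (e₁≼ c))) (Tρ≤U² S)))
                    (O-neg (O-weaken (O-* (v₁≼ c) (O-1 (e₂≼ c))) (Tρ≤U² S))))
               (t⁻¹≼ c))

    module Row (Cₐ Cᵦ : ℝ) where
      -- Models a row (a , b) of `h` by its size and by its pairing with (y , 1).
      record Row (S : Scale) : Set where
        field
          a b : ℝ
          a≼ : Big-O a Cₐ (Q S)
          ay+b≼ : Big-O (a * y + b) Cᵦ (u S)
      open Row

      -- (v₁ , v₂) is split into a multiple of (y , 1) and a deviation: a v₁ + b v₂ = a (v₁ - y v₂)
      -- + (a y + b) v₂. The deviation is small by `column`, and on (y , 1) the row is small, so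
      -- both terms are O(W).
      entry : ∀ C → ∃ λ C′ → ∀ {S} (r : Row S) {v₁ v₂} → Big-O (v₁ - y * v₂) C (U S ^ᴺ 2) → Big-O v₂ D (T S) →
              Big-O (a r * v₁ + b r * v₂) C′ (W S)
      entry C = _ , λ {S} r {v₁} {v₂} p q → O-resp
        (solve 5 (λ a b y v₁ v₂ → a :* (v₁ :- y :* v₂) :+ (a :* y :+ b) :* v₂ := a :* v₁ :+ b :* v₂) refl (a r) (b r) y v₁ v₂)
        (O-+ (O-weaken (O-* (a≼ r) p) (QU²≤W S)) (O-weaken (O-* (ay+b≼ r) q) (uT≤W S)))

      entry₁ : ∃ λ C → ∀ {S} (r : Row S) (c : Config S) → Big-O (a r * v₁ c + b r * v₂ c) C (W S)
      entry₁ = _ , λ r c → proj₂ (entry _) r (proj₂ column c) (v₂≼ c)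

      -- (a Λ₁ + b Λ₂) for Λ = γ x ≈ t (y , 1)
      dot : ∃ λ C → ∀ {S} (r : Row S) (c : Config S) →
            Big-O ((a r * v₁ c + b r * v₂ c) * x₁ + (a r * w₁ c + b r * w₂ c) * x₂) C (u S)
      dot = _ , λ {S} r c → O-resp
        (trans (solve 6 (λ a b y t e₁ e₂ → t :* (a :* y :+ b) :+ a :* e₁ :+ (a :* y :+ b) :* e₂ :- y :* (a :* e₂)
                  := a :* (e₁ :+ t :* y) :+ b :* (e₂ :+ t)) refl (a r) (b r) y (t c) (e₁ c) (e₂ c))
          (trans (+-cong (*-congˡ (solve 2 (λ x y → (x :- y) :+ y := x) refl _ _)) (*-congˡ (solve 2 (λ x y → (x :- y) :+ y := x) refl _ _)))
            (solve 8 (λ a b v₁ w₁ v₂ w₂ x₁ x₂ → a :* (v₁ :* x₁ :+ w₁ :* x₂) :+ b :* (v₂ :* x₁ :+ w₂ :* x₂)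
              := (a :* v₁ :+ b :* v₂) :* x₁ :+ (a :* w₁ :+ b :* w₂) :* x₂) refl (a r) (b r) (v₁ c) (w₁ c) (v₂ c) (w₂ c) x₁ x₂)))
        (O-+ (O-+ (O-+ (O-scale (ay+b≼ r) (t≼ c))
                       (O-weaken (O-* (a≼ r) (O-1 (e₁≼ c))) (Qρ≤u S)))
                  (O-weaken (O-* (ay+b≼ r) (O-1 (e₂≼ c))) (uρ≤u S)))
             (O-neg (O-scale (O-weaken (O-* (a≼ r) (O-1 (e₂≼ c))) (Qρ≤u S)) (x≼∣x∣ {y}))))

      module _ (ξ : ℝ) (x₂≉0 : ¬ x₂ ≈ 0#) (ξx₂≈x₁ : ξ * x₂ ≈ x₁) where

        slope : ∃ λ C → ∀ {S} (r : Row S) (c : Config S) →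
                Big-O ((a r * v₁ c + b r * v₂ c) * ξ + (a r * w₁ c + b r * w₂ c)) C (u S)
        slope = _ , λ r c → O-resp
          (cancel-t x₂ (x₂ ⁻¹) _ _ (F.*-inverseʳ x₂≉0)
            (trans (solve 4 (λ r₁ r₂ ξ x₂ → x₂ :* (r₁ :* ξ :+ r₂) := r₁ :* (ξ :* x₂) :+ r₂ :* x₂) refl _ _ ξ x₂)
              (+-congʳ (*-congˡ ξx₂≈x₁))))
          (O-scale (proj₂ dot r c) (x≼∣x∣ {x₂ ⁻¹}))

        -- Size of a row (r₁ , r₂) of `h γ` applied to a column (o , s) of `g`: `s` times the bound
        -- `u` for r₁ ξ + r₂, plus the error β of o/s, that is the absolute value of s ξ - o, times
        -- the bound `W` for r₁.
        X : Scale → ℝ → ℝ → ℝ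
        X S s β = s * u S + β * W S

        private
          s≤X : ∀ {S s β} → 0# ≤ β → s * u S ≤ X S s β
          s≤X {S} {s} {β} 0≤β = ≤-by (β * W S) (*-nonNeg 0≤β (*-nonNeg (pow-nonNeg 3 (0≤U S)) (pow-nonNeg 4 (0≤Z S))))
            (solve 2 (λ x y → (x :+ y) :- x := y) refl _ _)

          β≤X : ∀ {S s β} → 0# ≤ s → β * W S ≤ X S s β
          β≤X {S} {s} {β} 0≤s = ≤-by (s * u S) (*-nonNeg 0≤s (0≤u S))
            (solve 2 (λ x y → (x :+ y) :- y := x) refl _ _)

        -- A further change of basis by the Farey fractions o/s ≤ ξ ≤ o′/s′,
        -- β = s ξ - o and β′ = o′ - s′ ξ.
        lower-column : ∃ λ C → ∀ {S} (r : Row S) (c : Config S) {s o} → 0# ≤ s → 0# ≤ s * ξ - o →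
          Big-O ((a r * v₁ c + b r * v₂ c) * o + (a r * w₁ c + b r * w₂ c) * s) C (X S s (s * ξ - o))
        lower-column = _ , λ {S} r c {s} {o} 0≤s 0≤β → O-resp
          (solve 5 (λ s o ξ r₁ r₂ → s :* (r₁ :* ξ :+ r₂) :- (s :* ξ :- o) :* r₁ := r₁ :* o :+ r₂ :* s) refl s o ξ _ _)
          (O-+ (O-weaken (O-* (O-self 0≤s) (proj₂ slope r c)) (s≤X {S} 0≤β))
               (O-neg (O-weaken (O-* (O-self 0≤β) (proj₂ entry₁ r c)) (β≤X {S} 0≤s))))

        upper-column : ∃ λ C → ∀ {S} (r : Row S) (c : Config S) {s o} → 0# ≤ s → 0# ≤ o - s * ξ →
          Big-O ((a r * v₁ c + b r * v₂ c) * o + (a r * w₁ c + b r * w₂ c) * s) C (X S s (o - s * ξ))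
        upper-column = _ , λ {S} r c {s} {o} 0≤s 0≤β → O-resp
          (solve 5 (λ s o ξ r₁ r₂ → s :* (r₁ :* ξ :+ r₂) :+ (o :- s :* ξ) :* r₁ := r₁ :* o :+ r₂ :* s) refl s o ξ _ _)
          (O-+ (O-weaken (O-* (O-self 0≤s) (proj₂ slope r c)) (s≤X {S} 0≤β))
               (O-weaken (O-* (O-self 0≤β) (proj₂ entry₁ r c)) (β≤X {S} 0≤s)))

  -- Intervals, and matrix products seen in the field.

  record Interval : Set where
    constructor interval
    field
      left right : ℝ
      left≤right : left ≤ right

    width : ℝ
    width = right - left

  open Interval

  infix 4 _∈ᴵ_

  _∈ᴵ_ : ℝ → Interval → Set
  t ∈ᴵ I = left I ≤ t × t ≤ right I

  totalWidth : List Interval → ℝ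
  totalWidth []       = 0#
  totalWidth (I ∷ Is) = width I + totalWidth Is

  ball : ∀ {ρ} → 0# ≤ ρ → ℝ → Interval
  ball {ρ} 0≤ρ x = interval (x - ρ) (x + ρ) (≤-by (ρ + ρ) (+-nonNeg 0≤ρ 0≤ρ)
    (solve 2 (λ x ρ → (x :+ ρ) :- (x :- ρ) := ρ :+ ρ) refl x ρ))

  ∈-ball : ∀ {ρ t x} (0≤ρ : 0# ≤ ρ) → x - t ≼ ρ → t ∈ᴵ ball 0≤ρ x
  ∈-ball {ρ} {t} {x} _ (p , q) =
    ≤-by _ (0≤y-x p) (solve 3 (λ ρ t x → t :- (x :- ρ) := ρ :- (x :- t)) refl ρ t x) ,
    ≤-by _ (0≤y-x q) (solve 3 (λ ρ t x → (x :+ ρ) :- t := ρ :- :- (x :- t)) refl ρ t x)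

  totalWidth-balls : ∀ {A : Set} (f : A → ℝ) {ρ} (0≤ρ : 0# ≤ ρ) xs →
                     totalWidth (map (ball 0≤ρ ∘ f) xs) ≈ fromℕ (length xs) * (ρ + ρ)
  totalWidth-balls f         0≤ρ []       = sym (F.zeroˡ _)
  totalWidth-balls f {ρ = ρ} 0≤ρ (x ∷ xs) = trans (+-congˡ (totalWidth-balls f 0≤ρ xs))
    (solve 3 (λ x ρ n → ((x :+ ρ) :- (x :- ρ)) :+ n :* (ρ :+ ρ) := (con 1ℤ :+ n) :* (ρ :+ ρ)) refl (f x) ρ (fromℕ (length xs)))

  infixl 7 _∙_

  abstract
    _∙_ : Matrix₂ ℤ → Matrix₂ ℤ → Matrix₂ ℤ
    matrix a b c d ∙ matrix a′ b′ c′ d′ = matrix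
      (a ℤ.* a′ ℤ.+ b ℤ.* c′) (a ℤ.* b′ ℤ.+ b ℤ.* d′)
      (c ℤ.* a′ ℤ.+ d ℤ.* c′) (c ℤ.* b′ ℤ.+ d ℤ.* d′)

    SL₂ℤ-∙ : ∀ {γ δ} → SL₂ℤ γ → SL₂ℤ δ → SL₂ℤ (γ ∙ δ)
    SL₂ℤ-∙ {matrix a b c d} {matrix a′ b′ c′ d′} p q = ≡.trans
      (solveℤ 8
        (λ a b c d a′ b′ c′ d′ → (a ⊗ a′ ⊕ b ⊗ c′) ⊗ (c ⊗ b′ ⊕ d ⊗ d′) ⊖ (a ⊗ b′ ⊕ b ⊗ d′) ⊗ (c ⊗ a′ ⊕ d ⊗ c′)
          ⊜ (a ⊗ d ⊖ b ⊗ c) ⊗ (a′ ⊗ d′ ⊖ b′ ⊗ c′)) ≡.refl a b c d a′ b′ c′ d′)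
      (≡.cong₂ ℤ._*_ p q)
      where open ℤSolver using () renaming (solve to solveℤ; _:=_ to _⊜_; _:+_ to _⊕_; _:*_ to _⊗_; _:-_ to _⊖_)

    fromℤ-dot : ∀ a b c d → fromℤ (a ℤ.* b ℤ.+ c ℤ.* d) ≈ fromℤ a * fromℤ b + fromℤ c * fromℤ d
    fromℤ-dot a b c d = trans (fromℤ-+ (a ℤ.* b) (c ℤ.* d)) (+-cong (fromℤ-* a b) (fromℤ-* c d))

    ∙-a₁₁ : ∀ γ δ → fromℤ (a₁₁ (γ ∙ δ)) ≈ fromℤ (a₁₁ γ) * fromℤ (a₁₁ δ) + fromℤ (a₁₂ γ) * fromℤ (a₂₁ δ)
    ∙-a₁₁ (matrix a b c d) (matrix a′ b′ c′ d′) = fromℤ-dot a a′ b c′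

    ∙-a₁₂ : ∀ γ δ → fromℤ (a₁₂ (γ ∙ δ)) ≈ fromℤ (a₁₁ γ) * fromℤ (a₁₂ δ) + fromℤ (a₁₂ γ) * fromℤ (a₂₂ δ)
    ∙-a₁₂ (matrix a b c d) (matrix a′ b′ c′ d′) = fromℤ-dot a b′ b d′

    ∙-a₂₁ : ∀ γ δ → fromℤ (a₂₁ (γ ∙ δ)) ≈ fromℤ (a₂₁ γ) * fromℤ (a₁₁ δ) + fromℤ (a₂₂ γ) * fromℤ (a₂₁ δ)
    ∙-a₂₁ (matrix a b c d) (matrix a′ b′ c′ d′) = fromℤ-dot c a′ d c′

    ∙-a₂₂ : ∀ γ δ → fromℤ (a₂₂ (γ ∙ δ)) ≈ fromℤ (a₂₁ γ) * fromℤ (a₁₂ δ) + fromℤ (a₂₂ γ) * fromℤ (a₂₂ δ)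
    ∙-a₂₂ (matrix a b c d) (matrix a′ b′ c′ d′) = fromℤ-dot c b′ d d′

  fromℤ-≼ : ∀ {i b} → fromℤ i ≼ b → fromℕ ℤ.∣ i ∣ ≤ b
  fromℤ-≼ {+ m}       (p , _) = p
  fromℤ-≼ { -[1+ m ]} (_ , q) = ≤-respˡ (-‿involutive _) q

  -- The cover at a single scale.

  module Cover (l : ℕ) (x₁ x₂ y D A : ℝ) (x₂≉0 : ¬ x₂ ≈ 0#)
               (irr : Irrational y) (ωy≈1 : ω y ≈± [ 1# ]) where
    open Reduction l x₁ x₂ y D A

    -- The same K serves as quality of approximation, 1 + 1/K, and as order Z^(2K) of the bracket of
    -- `y`, so the loss is a single factor Z. With K = l + 3 the denominators are at most c⁻¹
    -- Z^(K+1) = c⁻¹ Q and the errors at most c⁻¹ z^k = c⁻¹ u z².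
    k K : ℕ
    k = suc (suc l)
    K = suc k

    ω-bound = irrationality-bound irr ωy≈1 k
    c = proj₁ ω-bound
    0<c = proj₁ (proj₂ ω-bound)
    c≤1 = proj₁ (proj₂ (proj₂ ω-bound))

    module Rows = Row (c ⁻¹) (c ⁻¹)
    open Rows
    open Rows.Row

    ξ : ℝ
    ξ = x₁ * x₂ ⁻¹

    ξx₂≈x₁ : ξ * x₂ ≈ x₁
    ξx₂≈x₁ = trans (solve 3 (λ a b i → (a :* i) :* b := a :* (b :* i)) refl x₁ x₂ (x₂ ⁻¹))
      (trans (*-congˡ (F.*-inverseʳ x₂≉0)) (F.*-identityʳ x₁))

    -- Absolute values are taken because nonnegativity of these constants comes with an estimate,
    -- hence only once a `Config` is given.
    C₁ C₂ : ℝ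
    C₁ = ∣ proj₁ (upper-column ξ x₂≉0 ξx₂≈x₁) ∣
    C₂ = ∣ proj₁ (lower-column ξ x₂≉0 ξx₂≈x₁) ∣

    -- 540 = 90 · 3 · 2, from `boundedSL₂ℤ`, from `X₁X₂≤3V` and from the length 2 ρ of an interval.
    coverWidth : ℝ
    coverWidth = fromℕ 540 * (C₁ * C₂)

    0≤coverWidth : 0# ≤ coverWidth
    0≤coverWidth = *-nonNeg (fromℕ-nonNeg 540) (*-nonNeg 0≤∣x∣ 0≤∣x∣)

    module _ (S : Scale) where
      open Scale S

      fareyʸ = farey y (Z ^ᴺ (K ℕ.+ K)) (1≤pow (K ℕ.+ K) 1≤Z)
      module H = Bracket (proj₁ fareyʸ)
      module Hᶠ = IsFarey (proj₂ fareyʸ)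

      fareyˣ = farey ξ T 1≤T
      module G = Bracket (proj₁ fareyˣ)
      module Gᶠ = IsFarey (proj₂ fareyˣ)

      -- The rows of `h` take the values α and α′ of the bracket of `y` on (y , 1). The columns of
      -- `g` are the bracket fractions of ξ written as vectors.
      h g : Matrix₂ ℤ
      h = matrix (+ H.q) (ℤ.- H.p) (ℤ.- + H.q′) H.p′
      g = matrix G.p′ G.p (+ G.q′) (+ G.q)

      h∈SL₂ℤ : SL₂ℤ h
      h∈SL₂ℤ = ≡.trans (solveℤ 4 (λ q p q′ p′ → q ⊗ p′ ⊖ (⊝ p) ⊗ (⊝ q′) ⊜ q ⊗ p′ ⊖ q′ ⊗ p) ≡.refl (+ H.q) H.p (+ H.q′) H.p′) H.det≡1
        where open ℤSolver using () renaming (solve to solveℤ; _:=_ to _⊜_; _:*_ to _⊗_; _:-_ to _⊖_; :-_ to ⊝_)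

      g∈SL₂ℤ : SL₂ℤ g
      g∈SL₂ℤ = ≡.trans (solveℤ 4 (λ q p q′ p′ → p′ ⊗ q ⊖ p ⊗ q′ ⊜ q ⊗ p′ ⊖ q′ ⊗ p) ≡.refl (+ G.q) G.p (+ G.q′) G.p′) G.det≡1
        where open ℤSolver using () renaming (solve to solveℤ; _:=_ to _⊜_; _:*_ to _⊗_; _:-_ to _⊖_)

      X₁ X₂ : ℝ
      X₁ = X ξ x₂≉0 ξx₂≈x₁ S (fromℕ G.q′) G.α′
      X₂ = X ξ x₂≉0 ξx₂≈x₁ S (fromℕ G.q) G.α

      V : ℝ
      V = (U ^ᴺ 2) * (Z ^ᴺ 4)

      0≤V : 0# ≤ V
      0≤V = *-nonNeg 0≤U² (pow-nonNeg 4 0≤Z)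

      0≤W : 0# ≤ W
      0≤W = *-nonNeg (pow-nonNeg 3 0≤U) (pow-nonNeg 4 0≤Z)

      -- The order T of the bracket of ξ balances the expansion: T u², u W and W²/T are all equal to
      -- V = T^(1/2) Z².
      X₁X₂≤3V : X₁ * X₂ ≤ fromℕ 3 * V
      X₁X₂≤3V = begin
        X₁ * X₂   ≈⟨ solve 6 (λ s s′ b b′ u W → (s′ :* u :+ b′ :* W) :* (s :* u :+ b :* W)
                       := ((s :* s′) :* u :^ 2 :+ (s :* b′ :+ s′ :* b) :* (u :* W)) :+ (b :* b′) :* W :^ 2)
                       refl (fromℕ G.q) (fromℕ G.q′) G.α G.α′ u W ⟩
        ((fromℕ G.q * fromℕ G.q′) * u ^ᴺ 2 + (fromℕ G.q * G.α′ + fromℕ G.q′ * G.α) * (u * W)) + (G.α * G.α′) * W ^ᴺ 2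
                  ≤⟨ +-mono-≤ (+-mono-≤ first (≤-reflexive second)) third ⟩
        (V + V) + V   ≈⟨ solve 1 (λ v → (v :+ v) :+ v := (con 1ℤ :+ (con 1ℤ :+ (con 1ℤ :+ con 0ℤ))) :* v) refl V ⟩
        fromℕ 3 * V   ∎
        where
        open ≤-Reasoning
        first : (fromℕ G.q * fromℕ G.q′) * u ^ᴺ 2 ≤ V
        first = ≤-trans (*-mono-≤ (*-nonNeg (fromℕ-nonNeg G.q) (fromℕ-nonNeg G.q′)) (pow-nonNeg 2 0≤u) Gᶠ.qq′≤N ≤-refl)
          (≤-reflexive (trans (solve 4 (λ U u Z z → (U :^ 4 :* Z :^ 4) :* u :^ 2 := (U :^ 2 :* Z :^ 4) :* ((U :* u) :^ 2 :* (Z :* z) :^ 0)) refl U u Z z) (cancel 2 0 V)))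
        second : (fromℕ G.q * G.α′ + fromℕ G.q′ * G.α) * (u * W) ≈ V
        second = trans (*-congʳ G.qα′+q′α≈1) (trans (F.*-identityˡ _) (trans
          (solve 4 (λ U u Z z → u :* (U :^ 3 :* Z :^ 4) := (U :^ 2 :* Z :^ 4) :* ((U :* u) :^ 1 :* (Z :* z) :^ 0)) refl U u Z z) (cancel 1 0 V)))
        third : (G.α * G.α′) * W ^ᴺ 2 ≤ V
        third = begin
          (G.α * G.α′) * W ^ᴺ 2    ≈⟨ solve 3 (λ b U Z → b :* (U :^ 3 :* Z :^ 4) :^ 2 := (b :* (U :^ 4 :* Z :^ 4)) :* (U :^ 2 :* Z :^ 4)) refl (G.α * G.α′) U Z ⟩
          (G.α * G.α′ * T) * V     ≤⟨ *-mono-≤ (*-nonNeg (*-nonNeg G.0≤α G.0≤α′) (≤-trans 0≤1 1≤T)) 0≤V Gᶠ.αα′N≤1 ≤-refl ⟩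
          1# * V                   ≈⟨ F.*-identityˡ V ⟩
          V                        ∎

      0≤X₁ : 0# ≤ X₁
      0≤X₁ = +-nonNeg (*-nonNeg (fromℕ-nonNeg G.q′) 0≤u) (*-nonNeg G.0≤α′ 0≤W)

      0≤X₂ : 0# ≤ X₂
      0≤X₂ = +-nonNeg (*-nonNeg (fromℕ-nonNeg G.q) 0≤u) (*-nonNeg G.0≤α 0≤W)

      -- The entries are integers, so rounding down loses none of them, and n₁ n₂ stays below the
      -- product C₁ X₁ C₂ X₂ even if one factor is less than 1.
      floor₁ = floorℕ (C₁ * X₁) (*-nonNeg 0≤∣x∣ 0≤X₁)
      floor₂ = floorℕ (C₂ * X₂) (*-nonNeg 0≤∣x∣ 0≤X₂)
      n₁ = proj₁ floor₁
      n₂ = proj₁ floor₂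

      matrices = boundedSL₂ℤ n₁ n₂

      -- The second entry of γ x, as a function of h γ g.
      f : Matrix₂ ℤ → ℝ
      f γ = x₂ * (fromℕ H.q′ * (G.α′ * fromℤ (a₁₂ γ) + G.α * fromℤ (a₁₁ γ)) + fromℕ H.q * (G.α′ * fromℤ (a₂₂ γ) + G.α * fromℤ (a₂₁ γ)))

      cover : List Interval
      cover = map (ball 0≤ρ ∘ f) (proj₁ matrices)

      totalWidth-cover : totalWidth cover ≤ coverWidth * (z ^ᴺ 2)
      totalWidth-cover = begin
        totalWidth cover                                          ≈⟨ totalWidth-balls f 0≤ρ (proj₁ matrices) ⟩
        fromℕ (length (proj₁ matrices)) * (ρ + ρ)                 ≤⟨ *-mono-≤ (fromℕ-nonNeg (length (proj₁ matrices))) 0≤2ρ (fromℕ-mono (proj₁ (proj₂ matrices))) ≤-refl ⟩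
        fromℕ (90 ℕ.* (n₁ ℕ.* n₂)) * (ρ + ρ)                      ≈⟨ *-congʳ (trans (fromℕ-* 90 (n₁ ℕ.* n₂)) (*-congˡ (fromℕ-* n₁ n₂))) ⟩
        fromℕ 90 * (fromℕ n₁ * fromℕ n₂) * (ρ + ρ)                ≤⟨ *-mono-≤ (*-nonNeg (fromℕ-nonNeg 90) (*-nonNeg (fromℕ-nonNeg n₁) (fromℕ-nonNeg n₂))) 0≤2ρ
                                                                       (*-monoˡ-≤ (fromℕ 90) (fromℕ-nonNeg 90) (*-mono-≤ (fromℕ-nonNeg n₁) (fromℕ-nonNeg n₂) (proj₁ (proj₂ floor₁)) (proj₁ (proj₂ floor₂)))) ≤-refl ⟩
        fromℕ 90 * ((C₁ * X₁) * (C₂ * X₂)) * (ρ + ρ)              ≈⟨ solve 6 (λ n C₁ C₂ X₁ X₂ ρ → n :* ((C₁ :* X₁) :* (C₂ :* X₂)) :* (ρ :+ ρ) := (n :* (C₁ :* C₂) :* (ρ :+ ρ)) :* (X₁ :* X₂)) refl (fromℕ 90) C₁ C₂ X₁ X₂ ρ ⟩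
        (fromℕ 90 * (C₁ * C₂) * (ρ + ρ)) * (X₁ * X₂)              ≤⟨ *-monoˡ-≤ _ (*-nonNeg (*-nonNeg (fromℕ-nonNeg 90) (*-nonNeg 0≤∣x∣ 0≤∣x∣)) 0≤2ρ) X₁X₂≤3V ⟩
        (fromℕ 90 * (C₁ * C₂) * (ρ + ρ)) * (fromℕ 3 * V)          ≈⟨ solve 6 (λ n m C₁ C₂ ρ V → (n :* (C₁ :* C₂) :* (ρ :+ ρ)) :* (m :* V) := ((con (+ 2) :* (n :* m)) :* (C₁ :* C₂)) :* (V :* ρ)) refl (fromℕ 90) (fromℕ 3) C₁ C₂ ρ V ⟩
        (((1# + 1#) * (fromℕ 90 * fromℕ 3)) * (C₁ * C₂)) * (V * ρ) ≈⟨ *-cong (*-congʳ 2*90*3≈540) Vρ≈z² ⟩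
        fromℕ 540 * (C₁ * C₂) * (z ^ᴺ 2)                          ∎
        where
        open ≤-Reasoning
        0≤2ρ = +-nonNeg 0≤ρ 0≤ρ
        2*90*3≈540 : (1# + 1#) * (fromℕ 90 * fromℕ 3) ≈ fromℕ 540
        2*90*3≈540 = sym (trans (fromℕ-* 2 270) (*-cong (+-congˡ fromℕ-1) (fromℕ-* 90 3)))
        Vρ≈z² : V * ρ ≈ z ^ᴺ 2
        Vρ≈z² = trans (solve 4 (λ U u Z z → (U :^ 2 :* Z :^ 4) :* (u :^ 2 :* z :^ 6) := z :^ 2 :* ((U :* u) :^ 2 :* (Z :* z) :^ 4)) refl U u Z z) (cancel 2 4 _)

      O-div : ∀ {x b g} → 0# ≤ x → c * x ≤ b → b ≤ g → Big-O x (c ⁻¹) g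
      O-div {x} {b} {g} 0≤x cx≤b b≤g = big-O (0≤x⁻¹ 0<c) (≼-trans (0≤x⇒x≼x 0≤x) (*-cancelˡ-≤ 0<c
        (≤-trans cx≤b (≤-trans b≤g (≤-reflexive (sym (trans (sym (F.*-assoc c (c ⁻¹) g)) (trans (*-congʳ (F.*-inverseʳ (0<⇒≉0 0<c))) (F.*-identityˡ g)))))))))

      Zᴷ⁺¹≤Q : Z ^ᴺ suc K ≤ Q
      Zᴷ⁺¹≤Q = ≤-reflexive (solve 2 (λ U Z → Z :* (Z :* (Z :* (Z :* U))) := U :* Z :^ 4) refl U Z)

      zᵏ≤u : z ^ᴺ k ≤ u
      zᵏ≤u = ≤-respˡ (solve 2 (λ u z → u :* z :^ 2 := z :* (z :* u)) refl u z) (xy≤x 0≤u z²≤1)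

      lower-value : fromℕ H.q * y + fromℤ (ℤ.- H.p) ≈ H.α
      lower-value = +-congˡ (fromℤ-neg H.p)

      upper-value : fromℤ (ℤ.- + H.q′) * y + fromℤ H.p′ ≈ H.α′
      upper-value = trans (+-congʳ (*-congʳ (fromℤ-neg (+ H.q′)))) (solve 3 (λ q y p → (:- q) :* y :+ p := p :- q :* y) refl (fromℕ H.q′) y (fromℤ H.p′))

      -- The lower bound for the error at one endpoint controls the denominator and the error at the
      -- other endpoint.
      lower-balanced = balanced 0<c c≤1 k 1≤Z 0≤z Zz≈1 (fromℕ-nonNeg H.q) (fromℕ-nonNeg H.q′) H.0≤α H.0≤α′
        (proj₂ (proj₂ (proj₂ ω-bound)) H.q′ (ℤ.- H.p′) H.1≤q′
          (≼-resp (trans (solve 3 (λ q y p → :- (p :- q :* y) := q :* y :+ :- p) refl (fromℕ H.q′) y (fromℤ H.p′)) (+-congˡ (sym (fromℤ-neg H.p′))))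
            (≼-neg (0≤x⇒x≼x H.0≤α′))))
        Hᶠ.qq′≤N Hᶠ.αα′N≤1 H.qα′≤1 H.q′α≤1

      upper-balanced = balanced 0<c c≤1 k 1≤Z 0≤z Zz≈1 (fromℕ-nonNeg H.q′) (fromℕ-nonNeg H.q) H.0≤α′ H.0≤α
        (proj₂ (proj₂ (proj₂ ω-bound)) H.q (ℤ.- H.p) H.1≤q (≼-resp (sym lower-value) (0≤x⇒x≼x H.0≤α)))
        (≤-respˡ (F.*-comm _ _) Hᶠ.qq′≤N) (≤-respˡ (*-congʳ (F.*-comm _ _)) Hᶠ.αα′N≤1) H.q′α≤1 H.qα′≤1

      lowerRow upperRow : Row S
      lowerRow = record
        { a = fromℤ (+ H.q) ; b = fromℤ (ℤ.- H.p)
        ; a≼ = O-div (fromℕ-nonNeg H.q) (proj₁ lower-balanced) Zᴷ⁺¹≤Q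
        ; ay+b≼ = O-resp (sym lower-value) (O-div H.0≤α (proj₂ lower-balanced) zᵏ≤u)
        }
      upperRow = record
        { a = fromℤ (ℤ.- + H.q′) ; b = fromℤ H.p′
        ; a≼ = O-resp (sym (fromℤ-neg (+ H.q′))) (O-neg (O-div (fromℕ-nonNeg H.q′) (proj₁ upper-balanced) Zᴷ⁺¹≤Q))
        ; ay+b≼ = O-resp (sym upper-value) (O-div H.0≤α′ (proj₂ upper-balanced) zᵏ≤u)
        }

      module _ (γ : Matrix₂ ℤ) where
        private
          v₁ = fromℤ (a₁₁ γ)
          w₁ = fromℤ (a₁₂ γ)
          v₂ = fromℤ (a₂₁ γ)
          w₂ = fromℤ (a₂₂ γ)

        hγg-a₁₁ : let r = lowerRow in
          fromℤ (a₁₁ (h ∙ γ ∙ g)) ≈ (a r * v₁ + b r * v₂) * fromℤ G.p′ + (a r * w₁ + b r * w₂) * fromℕ G.q′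
        hγg-a₁₁ = trans (∙-a₁₁ (h ∙ γ) g) (+-cong (*-congʳ (∙-a₁₁ h γ)) (*-congʳ (∙-a₁₂ h γ)))

        hγg-a₁₂ : let r = lowerRow in
          fromℤ (a₁₂ (h ∙ γ ∙ g)) ≈ (a r * v₁ + b r * v₂) * fromℤ G.p + (a r * w₁ + b r * w₂) * fromℕ G.q
        hγg-a₁₂ = trans (∙-a₁₂ (h ∙ γ) g) (+-cong (*-congʳ (∙-a₁₁ h γ)) (*-congʳ (∙-a₁₂ h γ)))

        hγg-a₂₁ : let r = upperRow in
          fromℤ (a₂₁ (h ∙ γ ∙ g)) ≈ (a r * v₁ + b r * v₂) * fromℤ G.p′ + (a r * w₁ + b r * w₂) * fromℕ G.q′
        hγg-a₂₁ = trans (∙-a₂₁ (h ∙ γ) g) (+-cong (*-congʳ (∙-a₂₁ h γ)) (*-congʳ (∙-a₂₂ h γ)))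

        hγg-a₂₂ : let r = upperRow in
          fromℤ (a₂₂ (h ∙ γ ∙ g)) ≈ (a r * v₁ + b r * v₂) * fromℤ G.p + (a r * w₁ + b r * w₂) * fromℕ G.q
        hγg-a₂₂ = trans (∙-a₂₂ (h ∙ γ) g) (+-cong (*-congʳ (∙-a₂₁ h γ)) (*-congʳ (∙-a₂₂ h γ)))

        private
          -- Undoes `g`: since its determinant is 1, the combination of its columns (p , q) and (p′
          -- , q′) with weights α′ and α is (ξ , 1).
          combine : ∀ {i j r₁ r₂} → fromℤ i ≈ r₁ * fromℤ G.p + r₂ * fromℕ G.q → fromℤ j ≈ r₁ * fromℤ G.p′ + r₂ * fromℕ G.q′ →
                    G.α′ * fromℤ i + G.α * fromℤ j ≈ r₁ * ξ + r₂
          combine {r₁ = r₁} {r₂} e e′ = trans (+-cong (*-congˡ e) (*-congˡ e′))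
            (trans (solve 7 (λ s s′ o o′ ξ r₁ r₂ → (o′ :- s′ :* ξ) :* (r₁ :* o :+ r₂ :* s) :+ (s :* ξ :- o) :* (r₁ :* o′ :+ r₂ :* s′)
                := (s :* o′ :- s′ :* o) :* (r₁ :* ξ :+ r₂)) refl (fromℕ G.q) (fromℕ G.q′) (fromℤ G.p) (fromℤ G.p′) ξ r₁ r₂)
              (trans (*-congʳ G.det≈1) (F.*-identityˡ _)))

          q q′ p p′ : ℝ
          q  = fromℕ H.q
          q′ = fromℕ H.q′
          p  = fromℤ H.p
          p′ = fromℤ H.p′

        -- After `combine`, the weights q′ and q undo `h`: q′ (q , - p) + q (- q′ , p′) = (0 , 1).
        -- The factor x₂ turns (ξ , 1) into (x₁ , x₂).
        f-second : f (h ∙ γ ∙ g) ≈ v₂ * x₁ + w₂ * x₂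
        f-second = begin
          f (h ∙ γ ∙ g)
            ≈⟨ *-congˡ (+-cong (*-congˡ (combine {a₁₂ (h ∙ γ ∙ g)} {a₁₁ (h ∙ γ ∙ g)} hγg-a₁₂ hγg-a₁₁)) (*-congˡ (combine {a₂₂ (h ∙ γ ∙ g)} {a₂₁ (h ∙ γ ∙ g)} hγg-a₂₂ hγg-a₂₁))) ⟩
          x₂ * (q′ * ((q * v₁ + fromℤ (ℤ.- H.p) * v₂) * ξ + (q * w₁ + fromℤ (ℤ.- H.p) * w₂))
              + q * ((fromℤ (ℤ.- + H.q′) * v₁ + p′ * v₂) * ξ + (fromℤ (ℤ.- + H.q′) * w₁ + p′ * w₂)))
            ≈⟨ *-congˡ (+-cong (*-congˡ (+-cong (*-congʳ (+-congˡ (*-congʳ (fromℤ-neg H.p)))) (+-congˡ (*-congʳ (fromℤ-neg H.p)))))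
                               (*-congˡ (+-cong (*-congʳ (+-congʳ (*-congʳ (fromℤ-neg (+ H.q′))))) (+-congʳ (*-congʳ (fromℤ-neg (+ H.q′))))))) ⟩
          x₂ * (q′ * ((q * v₁ + (- p) * v₂) * ξ + (q * w₁ + (- p) * w₂))
              + q * (((- q′) * v₁ + p′ * v₂) * ξ + ((- q′) * w₁ + p′ * w₂)))
            ≈⟨ *-congˡ (solve 9 (λ q q′ p p′ v₁ v₂ w₁ w₂ ξ →
                   q′ :* ((q :* v₁ :+ (:- p) :* v₂) :* ξ :+ (q :* w₁ :+ (:- p) :* w₂)) :+ q :* (((:- q′) :* v₁ :+ p′ :* v₂) :* ξ :+ ((:- q′) :* w₁ :+ p′ :* w₂))
                   := (q :* p′ :- q′ :* p) :* (v₂ :* ξ :+ w₂)) refl q q′ p p′ v₁ v₂ w₁ w₂ ξ) ⟩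
          x₂ * ((q * p′ - q′ * p) * (v₂ * ξ + w₂))
            ≈⟨ *-congˡ (*-congʳ H.det≈1) ⟩
          x₂ * (1# * (v₂ * ξ + w₂))
            ≈⟨ solve 4 (λ v w ξ x → x :* (con 1ℤ :* (v :* ξ :+ w)) := v :* (ξ :* x) :+ w :* x) refl v₂ w₂ ξ x₂ ⟩
          v₂ * (ξ * x₂) + w₂ * x₂
            ≈⟨ +-congʳ (*-congˡ ξx₂≈x₁) ⟩
          v₂ * x₁ + w₂ * x₂ ∎
          where open SetoidReasoning F.setoid

      entry₁≤ : ∀ (c : Config S) (r : Row S) {i} → fromℤ i ≈ (a r * Config.v₁ c + b r * Config.v₂ c) * fromℤ G.p′ + (a r * Config.w₁ c + b r * Config.w₂ c) * fromℕ G.q′ → ℤ.∣ i ∣ ℕ.≤ n₁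
      entry₁≤ c r {i} e = proj₂ (proj₂ floor₁) ℤ.∣ i ∣ (fromℤ-≼ {i} (≼-trans (≼-resp (sym e)
        (Big-O.bound (proj₂ (upper-column ξ x₂≉0 ξx₂≈x₁) r c (fromℕ-nonNeg G.q′) G.0≤α′)))
        (*-mono-≤ (Big-O.0≤C (proj₂ (upper-column ξ x₂≉0 ξx₂≈x₁) r c (fromℕ-nonNeg G.q′) G.0≤α′)) 0≤X₁ (proj₁ x≼∣x∣) ≤-refl)))

      entry₂≤ : ∀ (c : Config S) (r : Row S) {i} → fromℤ i ≈ (a r * Config.v₁ c + b r * Config.v₂ c) * fromℤ G.p + (a r * Config.w₁ c + b r * Config.w₂ c) * fromℕ G.q → ℤ.∣ i ∣ ℕ.≤ n₂
      entry₂≤ c r {i} e = proj₂ (proj₂ floor₂) ℤ.∣ i ∣ (fromℤ-≼ {i} (≼-trans (≼-resp (sym e)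
        (Big-O.bound (proj₂ (lower-column ξ x₂≉0 ξx₂≈x₁) r c (fromℕ-nonNeg G.q) G.0≤α)))
        (*-mono-≤ (Big-O.0≤C (proj₂ (lower-column ξ x₂≉0 ξx₂≈x₁) r c (fromℕ-nonNeg G.q) G.0≤α)) 0≤X₂ (proj₁ x≼∣x∣) ≤-refl)))

    -- The second coordinate of t (y , 1) is `t` itself, so `t` lies within ρ of the second
    -- coordinate of `γ x`, which is the centre `f (h γ g)`.
    cover-complete : ∀ S γ {t t⁻¹} → SL₂ℤ γ → t * t⁻¹ ≈ 1# → t ≼ A → t⁻¹ ≼ A →
      Big-O (fromℤ (a₁₁ γ)) D (Scale.T S) → Big-O (fromℤ (a₂₁ γ)) D (Scale.T S) →
      fromℤ (a₁₁ γ) * x₁ + fromℤ (a₁₂ γ) * x₂ - t * y ≼ Scale.ρ S →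
      fromℤ (a₂₁ γ) * x₁ + fromℤ (a₂₂ γ) * x₂ - t ≼ Scale.ρ S →
      Any (t ∈ᴵ_) (cover S)
    cover-complete S γ@(matrix v₁ w₁ v₂ w₂) {t} {t⁻¹} det tt⁻¹≈1 t≼ t⁻¹≼ v₁≼ v₂≼ e₁≼ e₂≼ =
      Any.map⁺ (List.lose
        (proj₂ (proj₂ (matrices S)) hγg
          (SL₂ℤ-∙ {h S ∙ γ} {g S} (SL₂ℤ-∙ {h S} {γ} (h∈SL₂ℤ S) det) (g∈SL₂ℤ S))
          (entry₁≤ S config (lowerRow S) {a₁₁ hγg} (hγg-a₁₁ S γ))
          (entry₂≤ S config (lowerRow S) {a₁₂ hγg} (hγg-a₁₂ S γ))
          (entry₁≤ S config (upperRow S) {a₂₁ hγg} (hγg-a₂₁ S γ))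
          (entry₂≤ S config (upperRow S) {a₂₂ hγg} (hγg-a₂₂ S γ)))
        (∈-ball (Scale.0≤ρ S) (≼-resp (+-congʳ (sym (f-second S γ))) e₂≼)))
      where
      hγg : Matrix₂ ℤ
      hγg = h S ∙ γ ∙ g S
      config : Config S
      config = record
        { v₁ = fromℤ v₁ ; w₁ = fromℤ w₁ ; v₂ = fromℤ v₂ ; w₂ = fromℤ w₂ ; t = t ; t⁻¹ = t⁻¹
        ; det≈1 = begin
            fromℤ v₁ * fromℤ w₂ - fromℤ w₁ * fromℤ v₂     ≈⟨ +-cong (fromℤ-* v₁ w₂) (-‿cong (fromℤ-* w₁ v₂)) ⟨
            fromℤ (v₁ ℤ.* w₂) - fromℤ (w₁ ℤ.* v₂)         ≈⟨ fromℤ-- (v₁ ℤ.* w₂) (w₁ ℤ.* v₂) ⟨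
            fromℤ (v₁ ℤ.* w₂ ℤ.- w₁ ℤ.* v₂)               ≡⟨ ≡.cong fromℤ det ⟩
            fromℕ 1                                       ≈⟨ fromℕ-1 ⟩
            1#                                            ∎
        ; tt⁻¹≈1 = tt⁻¹≈1 ; t≼ = t≼ ; t⁻¹≼ = t⁻¹≼ ; v₁≼ = v₁≼ ; v₂≼ = v₂≼ ; e₁≼ = e₁≼ ; e₂≼ = e₂≼
        }
        where open SetoidReasoning F.setoid

  -- Enumerating covers and the Borel-Cantelli argument.

  half : ℝ
  half = fromℕ 2 ⁻¹

  2*half≈1 : fromℕ 2 * half ≈ 1#
  2*half≈1 = F.*-inverseʳ (0<⇒≉0 (1≤⇒0< (1≤fromℕ-suc 1)))

  half+half≈1 : half + half ≈ 1#
  half+half≈1 = trans (solve 1 (λ h → h :+ h := (con 1ℤ :+ (con 1ℤ :+ con 0ℤ)) :* h) refl half) 2*half≈1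

  0≤half : 0# ≤ half
  0≤half = 0≤x⁻¹ (1≤⇒0< (1≤fromℕ-suc 1))

  half≤1 : half ≤ 1#
  half≤1 = ≤-respʳ half+half≈1 (≤-respˡ (F.+-identityʳ half) (+-mono-≤ ≤-refl 0≤half))

  2ⁿhalfⁿ≈1 : ∀ n → fromℕ 2 ^ᴺ n * half ^ᴺ n ≈ 1#
  2ⁿhalfⁿ≈1 n = trans (sym (^-distrib-* (fromℕ 2) half n)) (trans (^-congˡ n 2*half≈1) (1^n≈1 n))

  1+n≤2ⁿ : ∀ n → suc n ℕ.≤ 2 ℕ.^ n
  1+n≤2ⁿ zero    = ℕ.≤-refl
  1+n≤2ⁿ (suc n) = ℕ.≤-trans (ℕ.+-mono-≤ (ℕ.s≤s (ℕ.z≤n {n})) (1+n≤2ⁿ n))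
    (ℕ.≤-trans (ℕ.+-monoˡ-≤ (2 ℕ.^ n) (1+n≤2ⁿ n)) (ℕ.≤-reflexive (≡.cong (2 ℕ.^ n ℕ.+_) (≡.sym (ℕ.+-identityʳ _)))))

  [1+n]halfⁿ≤1 : ∀ n → fromℕ (suc n) * half ^ᴺ n ≤ 1#
  [1+n]halfⁿ≤1 n = ≤-trans
    (*-mono-≤ (fromℕ-nonNeg (suc n)) (pow-nonNeg n 0≤half) (≤-respʳ (fromℕ-^ 2 n) (fromℕ-mono (1+n≤2ⁿ n))) ≤-refl)
    (≤-reflexive (2ⁿhalfⁿ≈1 n))

  half-powers-vanish : ∀ C {δ} → 0# < δ → ∃ λ n → C * half ^ᴺ n ≤ δ
  half-powers-vanish C {δ} 0<δ = n , (begin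
    C * half ^ᴺ n                             ≈⟨ *-congʳ (trans (sym (F.*-identityʳ C)) (trans (*-congˡ (sym (F.*-inverseʳ (0<⇒≉0 0<δ)))) (solve 3 (λ C d i → C :* (d :* i) := d :* (C :* i)) refl C δ (δ ⁻¹)))) ⟩
    (δ * (C * δ ⁻¹)) * half ^ᴺ n              ≤⟨ *-mono′ (*-monoˡ-≤ δ (proj₁ 0<δ) (≤-trans Cδ⁻¹≤n (fromℕ-mono (ℕ.n≤1+n n)))) ⟩
    (δ * fromℕ (suc n)) * half ^ᴺ n           ≈⟨ F.*-assoc _ _ _ ⟩
    δ * (fromℕ (suc n) * half ^ᴺ n)           ≤⟨ *-monoˡ-≤ δ (proj₁ 0<δ) ([1+n]halfⁿ≤1 n) ⟩
    δ * 1#                                    ≈⟨ F.*-identityʳ δ ⟩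
    δ                                         ∎)
    where
    open ≤-Reasoning
    n = proj₁ (archimedean (C * δ ⁻¹))
    Cδ⁻¹≤n = proj₂ (archimedean (C * δ ⁻¹))
    *-mono′ : ∀ {a b} → a ≤ b → a * half ^ᴺ n ≤ b * half ^ᴺ n
    *-mono′ p = ≤-respˡ (F.*-comm _ _) (≤-respʳ (F.*-comm _ _) (*-monoˡ-≤ _ (pow-nonNeg n 0≤half) p))

  open Interval

  0≤width : ∀ I → 0# ≤ width I
  0≤width I = 0≤y-x (left≤right I)

  0≤totalWidth : ∀ Is → 0# ≤ totalWidth Is
  0≤totalWidth []       = ≤-refl
  0≤totalWidth (I ∷ Is) = +-nonNeg (0≤width I) (0≤totalWidth Is)

  totalWidth-++ : ∀ Is Js → totalWidth (Is ++ Js) ≈ totalWidth Is + totalWidth Js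
  totalWidth-++ []       Js = sym (F.+-identityˡ _)
  totalWidth-++ (I ∷ Is) Js = trans (+-congˡ (totalWidth-++ Is Js)) (sym (F.+-assoc _ _ _))

  totalWidth-concatMap : ∀ {A : Set} (f : A → List Interval) {b} → (∀ x → totalWidth (f x) ≤ b) →
                         ∀ xs → totalWidth (concatMap f xs) ≤ fromℕ (length xs) * b
  totalWidth-concatMap f       f≤b []       = ≤-reflexive (sym (F.zeroˡ _))
  totalWidth-concatMap f {b} f≤b (x ∷ xs) = ≤-respˡ (sym (totalWidth-++ (f x) (concatMap f xs)))
    (≤-trans (+-mono-≤ (f≤b x) (totalWidth-concatMap f f≤b xs))
      (≤-reflexive (solve 2 (λ b n → b :+ n :* b := (con 1ℤ :+ n) :* b) refl b (fromℕ (length xs)))))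

  -- Runs through `I ∷ Is` and then through the blocks `D 0`, `D 1` and so on. A block is a head
  -- with a tail, hence nonempty, so each index uses up one interval and the recursion is on the
  -- index.
  enumerate : Interval → List Interval → (ℕ → Interval × List Interval) → ℕ → Interval
  enumerate I Is       D zero    = I
  enumerate I []       D (suc i) = enumerate (proj₁ (D 0)) (proj₂ (D 0)) (D ∘ suc) i
  enumerate I (J ∷ Js) D (suc i) = enumerate J Js D i

  -- The allowance δ + δ is the sum of the geometric series. Passing to `D ∘ suc` halves δ, and δ +
  -- (δ/2 + δ/2) = δ + δ.
  sum-enumerate : ∀ n I Is D {δ} → 0# ≤ δ → (∀ k → totalWidth (uncurry _∷_ (D k)) ≤ δ * half ^ᴺ k) →
                  sum (λ (i : Fin n) → width (enumerate I Is D (toℕ i))) ≤ totalWidth (I ∷ Is) + (δ + δ)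
  sum-enumerate zero    I Is       D 0≤δ D≤ = +-nonNeg (0≤totalWidth (I ∷ Is)) (+-nonNeg 0≤δ 0≤δ)
  sum-enumerate (suc n) I []       D {δ} 0≤δ D≤ = ≤-trans
    (+-mono-≤ ≤-refl (≤-trans (sum-enumerate n (proj₁ (D 0)) (proj₂ (D 0)) (D ∘ suc) (*-nonNeg 0≤δ 0≤half)
        (λ k → ≤-respʳ (sym (F.*-assoc δ half _)) (D≤ (suc k))))
      (+-mono-≤ (D≤ 0) ≤-refl)))
    (≤-reflexive (trans (solve 3 (λ w δ h → w :+ (δ :* con 1ℤ :+ (δ :* h :+ δ :* h)) := (w :+ con 0ℤ) :+ (δ :+ δ :* (h :+ h))) refl (width I) δ half)
      (+-congˡ (+-congˡ (trans (*-congˡ half+half≈1) (F.*-identityʳ δ))))))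
  sum-enumerate (suc n) I (J ∷ Js) D 0≤δ D≤ = ≤-trans
    (+-mono-≤ ≤-refl (sum-enumerate n J Js D 0≤δ D≤))
    (≤-reflexive (sym (F.+-assoc _ _ _)))

  enumerate-∈ : ∀ {t} I Is D → Any (t ∈ᴵ_) (I ∷ Is) → ∃ λ i → t ∈ᴵ enumerate I Is D i
  enumerate-∈ I Is       D (here t∈I) = 0 , t∈I
  enumerate-∈ I (J ∷ Js) D (there p)  = let i , t∈ = enumerate-∈ J Js D p in suc i , t∈

  enumerate-∈D : ∀ {t} I Is D k → Any (t ∈ᴵ_) (uncurry _∷_ (D k)) → ∃ λ i → t ∈ᴵ enumerate I Is D i
  enumerate-∈D I []       D zero    p = let i , t∈ = enumerate-∈ (proj₁ (D 0)) (proj₂ (D 0)) (D ∘ suc) p in suc i , t∈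
  enumerate-∈D I []       D (suc k) p = let i , t∈ = enumerate-∈D (proj₁ (D 0)) (proj₂ (D 0)) (D ∘ suc) k p in suc i , t∈
  enumerate-∈D I (J ∷ Js) D k       p = let i , t∈ = enumerate-∈D J Js D k p in suc i , t∈

  -- Block `d` holds the covers with index `N l + d` for all l ≤ d, so that every l contributes a
  -- tail of its covers, begun where C l / 2^(N l) ≤ δ. Of the factor 4^-d that remains, one 2^-d
  -- pays for the d + 1 covers in the block and the other makes the blocks summable.
  borel-cantelli : ∀ {S : Pred ℝ 0ℓ} (C : ℕ → ℝ) (I : ℕ → ℕ → List Interval) →
    (∀ l → 0# ≤ C l) → (∀ l n → totalWidth (I l n) ≤ C l * (half ^ᴺ n) ^ᴺ 2) →
    (∀ {t} → S t → t ≈ 0# ⊎ ∃ λ l → ∀ m → ∃ λ n → m ℕ.≤ n × Any (t ∈ᴵ_) (I l n)) →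
    Null S
  borel-cantelli {S} C I 0≤C I≤ limsup ε 0<ε =
      left ∘ J , right ∘ J , (λ i → left≤right (J i)) ,
      (λ n → ≤-trans (sum-enumerate n point [] D (proj₁ 0<δ) D≤)
        (≤-reflexive (trans (+-congʳ (solve 0 ((con 0ℤ :- con 0ℤ) :+ con 0ℤ := con 0ℤ) refl)) (trans (F.+-identityˡ _) δ+δ≈ε)))) ,
      λ St → covers (limsup St)
    where
    δ = half * ε
    δ+δ≈ε : δ + δ ≈ ε
    δ+δ≈ε = trans (sym (F.distribʳ ε half half)) (trans (*-congʳ half+half≈1) (F.*-identityˡ ε))
    0<δ : 0# < δ
    0<δ = *-nonNeg 0≤half (proj₁ 0<ε) , λ 0≈δ → proj₂ 0<ε (trans (sym (F.+-identityˡ 0#)) (trans (+-cong 0≈δ 0≈δ) δ+δ≈ε))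

    -- Covers the exceptional t = 0 and makes every block nonempty.
    point : Interval
    point = interval 0# 0# ≤-refl

    N : ℕ → ℕ
    N l = proj₁ (half-powers-vanish (C l) 0<δ)

    D : ℕ → Interval × List Interval
    D d = point , concatMap (λ l → I l (N l ℕ.+ d)) (upTo (suc d))

    J = enumerate point [] D

    I≤δ : ∀ d l → totalWidth (I l (N l ℕ.+ d)) ≤ δ * (half ^ᴺ d) ^ᴺ 2
    I≤δ d l = begin
      totalWidth (I l (N l ℕ.+ d))                                    ≤⟨ I≤ l (N l ℕ.+ d) ⟩
      C l * (half ^ᴺ (N l ℕ.+ d)) ^ᴺ 2                                ≈⟨ *-congˡ (^-congˡ 2 (^-homo-* half (N l) d)) ⟩
      C l * (half ^ᴺ N l * half ^ᴺ d) ^ᴺ 2                            ≈⟨ solve 3 (λ C a b → C :* (a :* b) :^ 2 := (a :* (C :* a)) :* b :^ 2) refl (C l) (half ^ᴺ N l) (half ^ᴺ d) ⟩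
      (half ^ᴺ N l * (C l * half ^ᴺ N l)) * (half ^ᴺ d) ^ᴺ 2          ≤⟨ *-mono-≤ (*-nonNeg 0≤halfᴺ 0≤Chalfᴺ) 0≤halfᵈ (*-mono-≤ 0≤halfᴺ 0≤Chalfᴺ (pow≤1 (N l) 0≤half half≤1) (proj₂ (half-powers-vanish (C l) 0<δ))) ≤-refl ⟩
      (1# * δ) * (half ^ᴺ d) ^ᴺ 2                                     ≈⟨ *-congʳ (F.*-identityˡ δ) ⟩
      δ * (half ^ᴺ d) ^ᴺ 2                                            ∎
      where
      open ≤-Reasoning
      0≤halfᴺ = pow-nonNeg (N l) 0≤half
      0≤Chalfᴺ = *-nonNeg (0≤C l) 0≤halfᴺ
      0≤halfᵈ = pow-nonNeg 2 (pow-nonNeg d 0≤half)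

    D≤ : ∀ d → totalWidth (uncurry _∷_ (D d)) ≤ δ * half ^ᴺ d
    D≤ d = begin
      (0# - 0#) + totalWidth (proj₂ (D d))                        ≈⟨ trans (+-congʳ (F.-‿inverseʳ 0#)) (F.+-identityˡ _) ⟩
      totalWidth (proj₂ (D d))                                    ≤⟨ totalWidth-concatMap (λ l → I l (N l ℕ.+ d)) (I≤δ d) (upTo (suc d)) ⟩
      fromℕ (length (upTo (suc d))) * (δ * (half ^ᴺ d) ^ᴺ 2)      ≡⟨ ≡.cong (λ n → fromℕ n * (δ * (half ^ᴺ d) ^ᴺ 2)) (List.length-upTo (suc d)) ⟩
      fromℕ (suc d) * (δ * (half ^ᴺ d) ^ᴺ 2)                      ≈⟨ solve 3 (λ n δ h → n :* (δ :* h :^ 2) := (δ :* h) :* (n :* h)) refl (fromℕ (suc d)) δ (half ^ᴺ d) ⟩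
      (δ * half ^ᴺ d) * (fromℕ (suc d) * half ^ᴺ d)               ≤⟨ *-monoˡ-≤ _ (*-nonNeg (proj₁ 0<δ) (pow-nonNeg d 0≤half)) ([1+n]halfⁿ≤1 d) ⟩
      (δ * half ^ᴺ d) * 1#                                        ≈⟨ F.*-identityʳ _ ⟩
      δ * half ^ᴺ d                                               ∎
      where open ≤-Reasoning

    covers : ∀ {t} → t ≈ 0# ⊎ (∃ λ l → ∀ m → ∃ λ n → m ℕ.≤ n × Any (t ∈ᴵ_) (I l n)) → ∃ λ i → t ∈ᴵ J i
    covers (inj₁ t≈0) = 0 , ≤-reflexive (sym t≈0) , ≤-reflexive t≈0
    -- An index n ≥ N l + l has the form N l + d with l ≤ d, so its cover does occur in block d.
    covers {t} (inj₂ (l , io)) with io (N l ℕ.+ l)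
    ... | n , N+l≤n , t∈ = enumerate-∈D point [] D d (there (Any.concatMap⁺ (λ l → I l (N l ℕ.+ d)) (List.lose (List.∈-upTo⁺ (ℕ.s≤s l≤d)) (≡.subst (λ n → Any (t ∈ᴵ_) (I l n)) (≡.sym N+d≡n) t∈))))
      where
      d = n ℕ.∸ N l
      N+d≡n : N l ℕ.+ d ≡ n
      N+d≡n = ℕ.m+[n∸m]≡n (ℕ.≤-trans (ℕ.m≤m+n (N l) l) N+l≤n)
      l≤d : l ℕ.≤ d
      l≤d = ℕ.≤-trans (ℕ.≤-reflexive (≡.sym (ℕ.m+n∸m≡n (N l) l))) (ℕ.∸-monoˡ-≤ (N l) N+l≤n)

  -- Locating norms between thresholds and comparing real powers with ρ.

  finite-∥∥ᴹ≤ : ∀ M → Finite λ γ → ∥ γ ∥ᴹ ℕ.≤ M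
  finite-∥∥ᴹ≤ M = cartesianProductWith fromRows (rows M M) (rows M M) , λ {γ} → complete′ γ
    where
    fromRows : ℤ × ℤ → ℤ × ℤ → Matrix₂ ℤ
    fromRows (a , b) (c , d) = matrix a b c d

    complete′ : ∀ γ → ∥ γ ∥ᴹ ℕ.≤ M → γ ∈ cartesianProductWith fromRows (rows M M) (rows M M)
    complete′ (matrix a b c d) γ≤M =
      let abc≤M = ℕ.m⊔n≤o⇒m≤o _ ℤ.∣ d ∣ γ≤M
          ab≤M  = ℕ.m⊔n≤o⇒m≤o _ ℤ.∣ c ∣ abc≤M
      in List.∈-cartesianProductWith⁺ fromRows
        (∈-rows (ℕ.m⊔n≤o⇒m≤o ℤ.∣ a ∣ ℤ.∣ b ∣ ab≤M) (ℕ.m⊔n≤o⇒n≤o ℤ.∣ a ∣ ℤ.∣ b ∣ ab≤M))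
        (∈-rows (ℕ.m⊔n≤o⇒n≤o (ℤ.∣ a ∣ ℕ.⊔ ℤ.∣ b ∣) ℤ.∣ c ∣ abc≤M) (ℕ.m⊔n≤o⇒n≤o (ℤ.∣ a ∣ ℕ.⊔ ℤ.∣ b ∣ ℕ.⊔ ℤ.∣ c ∣) ℤ.∣ d ∣ γ≤M))

  infinite⇒unbounded : ∀ {P : Pred (Matrix₂ ℤ) 0ℓ} → Infinite P → ∀ M → ∃ λ γ → P γ × M ℕ.≤ ∥ γ ∥ᴹ
  infinite⇒unbounded {P} inf M with em {∃ λ γ → P γ × M ℕ.≤ ∥ γ ∥ᴹ}
  ... | yes p = p
  ... | no ¬p = contradiction
    (proj₁ (finite-∥∥ᴹ≤ M) , λ {γ} Pγ → proj₂ (finite-∥∥ᴹ≤ M) (ℕ.<⇒≤ (ℕ.≰⇒> λ M≤γ → ¬p (γ , Pγ , M≤γ)))) inf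

  -- The search runs downwards from an index whose threshold exceeds `b`; it stops at `m` at the
  -- latest because τ m ≤ b.
  level : (τ : ℕ → ℕ) → (∀ n → n ℕ.< τ n) → ∀ m {b} → τ m ℕ.≤ b → ∃ λ n → m ℕ.≤ n × τ n ℕ.≤ b × b ℕ.< τ (suc n)
  level τ n<τn m {b} τm≤b = search b (ℕ.≤-<-trans (ℕ.m≤m+n b m) (n<τn (b ℕ.+ m)))
    where
    search : ∀ k → b ℕ.< τ (k ℕ.+ m) → ∃ λ n → m ℕ.≤ n × τ n ℕ.≤ b × b ℕ.< τ (suc n)
    search zero    b<τ = contradiction b<τ (ℕ.≤⇒≯ τm≤b)
    search (suc k) b<τ with τ (k ℕ.+ m) ℕ.≤? b
    ... | yes τ≤b = k ℕ.+ m , ℕ.m≤n+m m k , τ≤b , b<τ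
    ... | no  τ≰b = search k (ℕ.≰⇒> τ≰b)

  fromℤ≼∣∣ : ∀ i → fromℤ i ≼ fromℕ ℤ.∣ i ∣
  fromℤ≼∣∣ (+ n)    = 0≤x⇒x≼x (fromℕ-nonNeg n)
  fromℤ≼∣∣ -[1+ n ] = ≼-neg (0≤x⇒x≼x (fromℕ-nonNeg (suc n)))

  module Powers (l : ℕ) where
    open Scales l
    open Scale

    -- The exponent 1/2 + 1/L is the fraction (L + 2)/E.
    L E : ℕ
    L = suc l
    E = 2 ℕ.* L

    T≈Z^ : ∀ S → T S ≈ Z S ^ᴺ (l ℕ.* 4 ℕ.+ 4)
    T≈Z^ S = trans (*-congʳ (^-assocʳ (Z S) l 4)) (sym (^-homo-* (Z S) (l ℕ.* 4) 4))

    -- The inverse of ρ, that is T to the power (L + 2)/E, as `Y^E≈T^` says with integer exponents.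
    Y : Scale → ℝ
    Y S = (U S ^ᴺ 2) * (Z S ^ᴺ 6)

    Y^E≈T^ : ∀ S → Y S ^ᴺ E ≈ T S ^ᴺ (L ℕ.+ 2)
    Y^E≈T^ S = begin
      Y S ^ᴺ E                                         ≈⟨ ^-congˡ E (trans (*-congʳ (^-assocʳ (Z S) l 2)) (sym (^-homo-* (Z S) (l ℕ.* 2) 6))) ⟩
      (Z S ^ᴺ (l ℕ.* 2 ℕ.+ 6)) ^ᴺ E                    ≈⟨ ^-assocʳ (Z S) (l ℕ.* 2 ℕ.+ 6) E ⟩
      Z S ^ᴺ ((l ℕ.* 2 ℕ.+ 6) ℕ.* E)                   ≡⟨ ≡.cong (Z S ^ᴺ_) (ℕSolver.solve 1 (λ l → (l ℕ:* two ℕ:+ ℕSolver.con 6) ℕ:* (two ℕ:* (ℕSolver.con 1 ℕ:+ l))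
                                                             ℕ:= (l ℕ:* ℕSolver.con 4 ℕ:+ ℕSolver.con 4) ℕ:* (ℕSolver.con 1 ℕ:+ l ℕ:+ two)) ≡.refl l) ⟩
      Z S ^ᴺ ((l ℕ.* 4 ℕ.+ 4) ℕ.* (L ℕ.+ 2))           ≈⟨ ^-assocʳ (Z S) (l ℕ.* 4 ℕ.+ 4) (L ℕ.+ 2) ⟨
      (Z S ^ᴺ (l ℕ.* 4 ℕ.+ 4)) ^ᴺ (L ℕ.+ 2)            ≈⟨ ^-congˡ (L ℕ.+ 2) (T≈Z^ S) ⟨
      T S ^ᴺ (L ℕ.+ 2)                                 ∎
      where
      open SetoidReasoning F.setoid
      open ℕSolver using () renaming (_:+_ to _ℕ:+_; _:*_ to _ℕ:*_; _:=_ to _ℕ:=_)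
      two : ∀ {n} → ℕSolver.Polynomial n
      two = ℕSolver.con 2

    -- ρ is T to the power - (1/2 + 1/L).
    power≤ρ : ∀ S {b m e} → T S ≤ fromℕ b → fromℕ (L ℕ.+ 2) ≤ fromℕ E * m → [ e ] ≤± (b ^ (- m)) → e ≤ ρ S
    power≤ρ S {b} {m} T≤b L+2≤Em = ⨆-upper bound
      where
      1≤b : 1# ≤ fromℕ b
      1≤b = ≤-trans (1≤T S) T≤b
      1≤Y : 1# ≤ Y S
      1≤Y = ≤-respˡ (F.*-identityˡ 1#) (*-mono-≤ 0≤1 0≤1 (1≤pow 2 (1≤U S)) (1≤pow 6 (1≤Z S)))
      Yρ≈1 : Y S * ρ S ≈ 1#
      Yρ≈1 = trans (solve 4 (λ U u Z z → (U :^ 2 :* Z :^ 6) :* (u :^ 2 :* z :^ 6) := con 1ℤ :* ((U :* u) :^ 2 :* (Z :* z) :^ 6))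
        refl (U S) (u S) (Z S) (z S)) (cancel S 2 6 1#)

      exponent : ∀ i N′ → fromℤ i * fromℕ (suc N′) ⁻¹ ≤ - m → fromℕ E * fromℤ i ≤ - fromℕ ((L ℕ.+ 2) ℕ.* suc N′)
      exponent i N′ p = begin
        fromℕ E * fromℤ i                        ≈⟨ *-congˡ (trans (sym (F.*-identityʳ _)) (trans (*-congˡ (sym (F.*-inverseʳ (0<⇒≉0 (1≤⇒0< (1≤fromℕ-suc N′))))))
                                                     (solve 3 (λ i n j → i :* (n :* j) := n :* (i :* j)) refl (fromℤ i) N (N ⁻¹)))) ⟩
        fromℕ E * (N * (fromℤ i * N ⁻¹))         ≤⟨ *-monoˡ-≤ _ (fromℕ-nonNeg E) (*-monoˡ-≤ _ (fromℕ-nonNeg (suc N′)) p) ⟩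
        fromℕ E * (N * - m)                      ≈⟨ solve 3 (λ e n m → e :* (n :* :- m) := :- (n :* (e :* m))) refl (fromℕ E) N m ⟩
        - (N * (fromℕ E * m))                    ≤⟨ neg-mono-≤ (*-monoˡ-≤ _ (fromℕ-nonNeg (suc N′)) L+2≤Em) ⟩
        - (N * fromℕ (L ℕ.+ 2))                  ≈⟨ -‿cong (trans (fromℕ-* (L ℕ.+ 2) (suc N′)) (F.*-comm _ _)) ⟨
        - fromℕ ((L ℕ.+ 2) ℕ.* suc N′)           ∎
        where
        open ≤-Reasoning
        N = fromℕ (suc N′)

      bound : ∀ {r} → (∃ λ q → fromℚ q ≤ - m × IsRationalPower (fromℕ b) q r) → r ≤ ρ S
      -- A nonnegative exponent cannot lie below - m, as m ≥ (L + 2)/E > 0.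
      bound (mkℚ (+ p) N′ _ , q≤-m , _) = contradiction
        (fromℕ-cancel {(L ℕ.+ 2) ℕ.* suc N′} {0} (≤-by _ (+-nonNeg (0≤y-x (exponent (+ p) N′ q≤-m)) (*-nonNeg (fromℕ-nonNeg E) (fromℕ-nonNeg p)))
          (solve 2 (λ x z → con 0ℤ :- x := (:- x :- z) :+ z) refl (fromℕ ((L ℕ.+ 2) ℕ.* suc N′)) (fromℕ E * fromℕ p))))
        (ℕ.<⇒≱ (ℕ.s≤s ℕ.z≤n))
      -- For the exponent - P/N one has P/N ≥ (L + 2)/E. Hence (Y r)^(N E) = T^((L+2) N) r^(N E) ≤
      -- b^(P E) b^(-P E) = 1, and Y r ≤ 1 = Y ρ.
      bound {r} (mkℚ -[1+ p ] N′ _ , q≤-m , (0≤r , _) , rᴺ≈) = *-cancelˡ-≤ (1≤⇒0< 1≤Y) (≤-respʳ (sym Yρ≈1)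
          (pow-cancel-≤ (ℕ.pred (N ℕ.* E)) (*-nonNeg 0≤Y 0≤r) 0≤1 (begin
            (Y S * r) ^ᴺ (N ℕ.* E)                            ≈⟨ ^-distrib-* (Y S) r (N ℕ.* E) ⟩
            Y S ^ᴺ (N ℕ.* E) * r ^ᴺ (N ℕ.* E)                 ≈⟨ *-cong Y^NE (sym (^-assocʳ r N E)) ⟩
            T S ^ᴺ ((L ℕ.+ 2) ℕ.* N) * (r ^ᴺ N) ^ᴺ E          ≤⟨ *-mono-≤ (pow-nonNeg ((L ℕ.+ 2) ℕ.* N) 0≤T) 0≤rᴺᴱ (≤-trans (pow-mono ((L ℕ.+ 2) ℕ.* N) 0≤T T≤b) (pow-monoʳ 1≤b [L+2]N≤PE)) ≤-refl ⟩
            fromℕ b ^ᴺ (P ℕ.* E) * (r ^ᴺ N) ^ᴺ E              ≈⟨ *-congʳ (sym (^-assocʳ (fromℕ b) P E)) ⟩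
            (fromℕ b ^ᴺ P) ^ᴺ E * (r ^ᴺ N) ^ᴺ E               ≈⟨ ^-distrib-* (fromℕ b ^ᴺ P) (r ^ᴺ N) E ⟨
            (fromℕ b ^ᴺ P * r ^ᴺ N) ^ᴺ E                      ≈⟨ ^-congˡ E (trans (*-congˡ rᴺ≈) (F.*-inverseʳ (0<⇒≉0 (1≤⇒0< (1≤pow P 1≤b))))) ⟩
            1# ^ᴺ E                                           ≈⟨ trans (1^n≈1 E) (sym (1^n≈1 (N ℕ.* E))) ⟩
            1# ^ᴺ (N ℕ.* E)                                   ∎)))
        where
        open ≤-Reasoning
        N = suc N′
        P = suc p
        0≤Y = ≤-trans 0≤1 1≤Y
        0≤T = ≤-trans 0≤1 (1≤T S)
        0≤rᴺᴱ = pow-nonNeg E (pow-nonNeg N 0≤r)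
        [L+2]N≤PE : (L ℕ.+ 2) ℕ.* N ℕ.≤ P ℕ.* E
        [L+2]N≤PE = fromℕ-cancel (≤-respʳ (sym (fromℕ-* P E)) (≤-by _ (0≤y-x (exponent -[1+ p ] N′ q≤-m))
          (solve 3 (λ x e P → P :* e :- x := :- x :- e :* :- P) refl (fromℕ ((L ℕ.+ 2) ℕ.* N)) (fromℕ E) (fromℕ P))))
        Y^NE : Y S ^ᴺ (N ℕ.* E) ≈ T S ^ᴺ ((L ℕ.+ 2) ℕ.* N)
        Y^NE = trans (reflexive (≡.cong (Y S ^ᴺ_) (ℕ.*-comm N E))) (trans (sym (^-assocʳ (Y S) E N))
          (trans (^-congˡ N (Y^E≈T^ S)) (^-assocʳ (T S) (L ℕ.+ 2) N)))

  dyadicScale : ∀ l → ℕ → Scales.Scale l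
  dyadicScale l n = record
    { Z = fromℕ 2 ^ᴺ n ; z = half ^ᴺ n ; 1≤Z = 1≤pow n (1≤fromℕ-suc 1) ; 0≤z = pow-nonNeg n 0≤half ; Zz≈1 = 2ⁿhalfⁿ≈1 n }

  -- The exceptional points of the line.

  module Main (x₁ x₂ y : ℝ) (x₂≉0 : ¬ x₂ ≈ 0#) (irr : Irrational y) (ωy≈1 : ω y ≈± [ 1# ]) where

    exponentT : ℕ → ℕ
    exponentT l = l ℕ.* 4 ℕ.+ 4

    τ : ℕ → ℕ → ℕ
    τ l n = (2 ℕ.^ n) ℕ.^ exponentT l

    n<τ : ∀ l n → n ℕ.< τ l n
    n<τ l n = ℕ.≤-trans (1+n≤2ⁿ n) (ℕ.≤-trans (ℕ.≤-reflexive (≡.sym (ℕ.*-identityʳ _)))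
      (ℕ.^-monoʳ-≤ (2 ℕ.^ n) {{ℕ.m^n≢0 2 n}} {1} {exponentT l} (ℕ.≤-trans (ℕ.s≤s ℕ.z≤n) (ℕ.m≤n+m 4 (l ℕ.* 4)))))

    -- The ratio of consecutive thresholds: a norm below `τ l (suc n)` bounds the entries by `D l`
    -- times T.
    D : ℕ → ℝ
    D l = fromℕ 2 ^ᴺ exponentT l

    0≤D : ∀ l → 0# ≤ D l
    0≤D l = pow-nonNeg (exponentT l) (fromℕ-nonNeg 2)

    T≈τ : ∀ l n → Scales.Scale.T (dyadicScale l n) ≈ fromℕ (τ l n)
    T≈τ l n = trans (Powers.T≈Z^ l (dyadicScale l n)) (sym (trans (fromℕ-^ (2 ℕ.^ n) (exponentT l)) (^-congˡ (exponentT l) (fromℕ-^ 2 n))))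

    DT≈τ : ∀ l n → D l * Scales.Scale.T (dyadicScale l n) ≈ fromℕ (τ l (suc n))
    DT≈τ l n = trans (*-congˡ (Powers.T≈Z^ l (dyadicScale l n))) (trans (sym (^-distrib-* (fromℕ 2) (fromℕ 2 ^ᴺ n) (exponentT l)))
      (sym (trans (fromℕ-^ (2 ℕ.^ suc n) (exponentT l)) (^-congˡ (exponentT l) (fromℕ-^ 2 (suc n))))))

    module C (l : ℕ) = Cover l x₁ x₂ y (D l) (fromℕ (suc l)) x₂≉0 irr ωy≈1

    S : Pred ℝ 0ℓ
    S t = ¬ (μ (x₁ , x₂) (t • (y , 1#)) ≤± [ fromℚ ½ ])

    -- This is m ≥ 1/2 + 1/L with denominators cleared, valid once L is at least the inverse of m -
    -- 1/2.
    large-exponent : ∀ l {m} → (m - fromℚ ½) ⁻¹ ≤ fromℕ (suc l) → 0# < m - fromℚ ½ → fromℕ (suc l ℕ.+ 2) ≤ fromℕ (2 ℕ.* suc l) * m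
    large-exponent l {m} d⁻¹≤L 0<d = begin
      fromℕ (suc l ℕ.+ 2)                       ≈⟨ trans (fromℕ-+ (suc l) 2) (+-cong (sym (F.*-identityʳ _)) (sym (F.*-identityʳ _))) ⟩
      L * 1# + fromℕ 2 * 1#                     ≤⟨ +-mono-≤ ≤-refl (*-monoˡ-≤ _ (fromℕ-nonNeg 2) 1≤dL) ⟩
      L * 1# + fromℕ 2 * (d * L)                ≈⟨ +-congʳ (*-congˡ (trans (sym 2*half≈1) (*-congˡ (sym ½≈half)))) ⟩
      L * (fromℕ 2 * fromℚ ½) + fromℕ 2 * (d * L) ≈⟨ solve 4 (λ L t h m → L :* (t :* h) :+ t :* ((m :- h) :* L) := (t :* L) :* m) refl L (fromℕ 2) (fromℚ ½) m ⟩
      (fromℕ 2 * L) * m                         ≈⟨ *-congʳ (fromℕ-* 2 (suc l)) ⟨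
      fromℕ (2 ℕ.* suc l) * m                   ∎
      where
      open ≤-Reasoning
      L = fromℕ (suc l)
      d = m - fromℚ ½
      ½≈half : fromℚ ½ ≈ half
      ½≈half = trans (*-congʳ fromℕ-1) (F.*-identityˡ half)
      1≤dL : 1# ≤ d * L
      1≤dL = ≤-respˡ (F.*-inverseʳ (0<⇒≉0 0<d)) (*-monoˡ-≤ d (proj₁ 0<d) d⁻¹≤L)

    module _ {t} (t≉0 : ¬ t ≈ 0#) {m} (m≰½ : ¬ m ≤ fromℚ ½) where
      private
        d = m - fromℚ ½
        n₁ = proj₁ (∃-bound t)
        n₂ = proj₁ (∃-bound (t ⁻¹))
        n₃ = proj₁ (archimedean (d ⁻¹))

        l : ℕ
        -- A single L = l + 1 has to dominate the absolute values of `t` and of its inverse, and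
        -- also the inverse of m - 1/2.
        l = n₁ ℕ.+ n₂ ℕ.+ n₃

        n₁≤ : n₁ ℕ.≤ suc l
        n₁≤ = ℕ.m≤n⇒m≤1+n (ℕ.≤-trans (ℕ.m≤m+n n₁ n₂) (ℕ.m≤m+n _ n₃))

        n₂≤ : n₂ ℕ.≤ suc l
        n₂≤ = ℕ.m≤n⇒m≤1+n (ℕ.≤-trans (ℕ.m≤n+m n₂ n₁) (ℕ.m≤m+n _ n₃))

        n₃≤ : n₃ ℕ.≤ suc l
        n₃≤ = ℕ.m≤n⇒m≤1+n (ℕ.m≤n+m n₃ (n₁ ℕ.+ n₂))

        0<d : 0# < d
        0<d = 0≤y-x (≰⇒≥ m≰½) , λ 0≈d → m≰½ (≤-by 0# ≤-refl (trans (solve 2 (λ m h → h :- m := :- (m :- h)) refl m (fromℚ ½)) (trans (-‿cong (sym 0≈d)) -0#≈0#)))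

      covered : ∀ n γ → SL₂ℤ γ → [ ∥ (γ ▹ (x₁ , x₂)) -² (t • (y , 1#)) ∥ ] ≤± (∥ γ ∥ᴹ ^ (- m)) →
                τ l n ℕ.≤ ∥ γ ∥ᴹ → ∥ γ ∥ᴹ ℕ.< τ l (suc n) → Any (t ∈ᴵ_) (C.cover l (dyadicScale l n))
      covered n γ@(matrix v₁ w₁ v₂ w₂) det near τ≤ <τ = C.cover-complete l (dyadicScale l n) γ det
          (F.*-inverseʳ t≉0)
          (≼-trans (proj₂ (∃-bound t)) (fromℕ-mono n₁≤)) (≼-trans (proj₂ (∃-bound (t ⁻¹))) (fromℕ-mono n₂≤))
          (entry v₁ (ℕ.≤-trans (ℕ.m≤m⊔n _ _) (ℕ.≤-trans (ℕ.m≤m⊔n _ ℤ.∣ v₂ ∣) (ℕ.m≤m⊔n _ ℤ.∣ w₂ ∣))))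
          (entry v₂ (ℕ.≤-trans (ℕ.m≤n⊔m (ℤ.∣ v₁ ∣ ℕ.⊔ ℤ.∣ w₁ ∣) _) (ℕ.m≤m⊔n _ ℤ.∣ w₂ ∣)))
          (∣∣≤⇒≼ (⊔.x⊔y≤z⇒x≤z _ _ near≤ρ))
          (≼-resp (+-congˡ (-‿cong (F.*-identityʳ t))) (∣∣≤⇒≼ (⊔.x⊔y≤z⇒y≤z _ _ near≤ρ)))
        where
        near≤ρ : ∥ (γ ▹ (x₁ , x₂)) -² (t • (y , 1#)) ∥ ≤ Scales.Scale.ρ (dyadicScale l n)
        near≤ρ = Powers.power≤ρ l (dyadicScale l n) {∥ γ ∥ᴹ} (≤-respˡ (sym (T≈τ l n)) (fromℕ-mono τ≤))
          (large-exponent l (≤-trans (proj₂ (archimedean (d ⁻¹))) (fromℕ-mono n₃≤)) 0<d) near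
        entry : ∀ i → ℤ.∣ i ∣ ℕ.≤ ∥ γ ∥ᴹ → Big-O (fromℤ i) (D l) (Scales.Scale.T (dyadicScale l n))
        entry i i≤γ = big-O (0≤D l) (≼-trans (fromℤ≼∣∣ i) (≤-respʳ (sym (DT≈τ l n)) (fromℕ-mono (ℕ.≤-trans i≤γ (ℕ.<⇒≤ <τ)))))

      covered-infinitely-often : Infinite (SL₂ℤ ∩ λ γ → [ ∥ (γ ▹ (x₁ , x₂)) -² (t • (y , 1#)) ∥ ] ≤± (∥ γ ∥ᴹ ^ (- m))) →
        ∃ λ l → ∀ n₀ → ∃ λ n → n₀ ℕ.≤ n × Any (t ∈ᴵ_) (C.cover l (dyadicScale l n))
      covered-infinitely-often inf = l , λ n₀ →
        let γ , (det , near) , τ≤γ = infinite⇒unbounded inf (τ l n₀)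
            n , n₀≤n , τ≤ , <τ = level (τ l) (n<τ l) n₀ τ≤γ
        in n , n₀≤n , covered n γ det near τ≤ <τ

    limsup : ∀ {t} → S t → t ≈ 0# ⊎ ∃ λ l → ∀ n₀ → ∃ λ n → n₀ ℕ.≤ n × Any (t ∈ᴵ_) (C.cover l (dyadicScale l n))
    limsup St = or-else λ t≉0 → let m , inf , m≰½ = ⨆≰⇒∃ St in covered-infinitely-often t≉0 m≰½ inf
      where
      or-else : ∀ {P Q : Set} → (¬ P → Q) → P ⊎ Q
      or-else {P} f with em {P}
      ... | yes p = inj₁ p
      ... | no ¬p = inj₂ (f ¬p)

    almostAll : AlmostAllOnLine (y , 1#) (λ 𝐲 → μ (x₁ , x₂) 𝐲 ≤± [ fromℚ ½ ])
    almostAll = borel-cantelli C.coverWidth (λ l n → C.cover l (dyadicScale l n))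
      C.0≤coverWidth (λ l n → C.totalWidth-cover l (dyadicScale l n)) limsup

theorem3 : (em : ExcludedMiddle 0ℓ) (R : CompleteOrderedField) →
    let open Real em R in
    (𝐱 : ℝ²) (y : ℝ) →
    HasIrrationalSlope 𝐱 →
    Irrational y →
    ω y ≈± [ 1# ] →
    AlmostAllOnLine (y , 1#) (λ 𝐲 → μ 𝐱 𝐲 ≤± [ fromℚ ½ ])
theorem3 em R (x₁ , x₂) y (x₂≉0 , _) irr ωy≈1 = Proof.Main.almostAll em R x₁ x₂ y x₂≉0 irr ωy≈1
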